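{- $R_3(P_9) \le 17$.
   Context: All graphs are undirected, finite, with no loops or multiple edges. $P_k$ denotes the path on $k$ vertices, and $K_N$ denotes the complete graph on $N$ vertices. For a graph $G$, the three-color diagonal Ramsey number $R_3(G) = R(G,G,G)$ is the smallest integer $N$ such that every coloring of the edges of $K_N$ with 3 colors contains a monochromatic copy of $G$ (as a not necessarily induced subgraph), i.e. there is a color $i \in \{1,2,3\}$ such that the graph formed by the edges of color $i$ contains a subgraph isomorphic to $G$. -}

module Defs where

open import Data.Fin using (Fin; toℕ)
import Data.Fin.Properties as Fin
open import Data.Nat using (ℕ; suc; _≤_)
import Data.Nat.Properties as ℕ
open import Data.Product using (Σ; ∃; _×_; _,_)
open import Data.Sum using (_⊎_; inj₁; inj₂; swap)
open import Function using (_∘_)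
open import Function.Definitions using (Injective)
open import Level using (0ℓ)
open import Relation.Binary
  using (Rel; Symmetric; Irreflexive; Decidable; _Preserves_⟶_)
open import Relation.Binary.PropositionalEquality
  using (_≡_; _≢_; refl; sym; trans)
open import Relation.Nullary.Decidable using (¬?; _×-dec_; _⊎-dec_)

record Graph (n : ℕ) : Set₁ where
  field
    Adj    : Rel (Fin n) 0ℓ
    symm   : Symmetric Adj
    irrefl : Irreflexive _≡_ Adj
    adj?   : Decidable Adj

open Graph public

complete : ∀ n → Graph n
complete n .Adj              = _≢_
complete n .symm u≢v         = u≢v ∘ sym
complete n .irrefl u≡v u≢v   = u≢v u≡v
complete n .adj? u v         = ¬? (u Fin.≟ v)

-- The index counts vertices, not edges.
path : ∀ n → Graph n
path n .Adj u v              = toℕ v ≡ suc (toℕ u) ⊎ toℕ u ≡ suc (toℕ v)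
path n .symm                 = swap
path n .irrefl refl (inj₁ p) = ℕ.1+n≢n (sym p)
path n .irrefl refl (inj₂ p) = ℕ.1+n≢n (sym p)
path n .adj? u v             =
  (toℕ v ℕ.≟ suc (toℕ u)) ⊎-dec (toℕ u ℕ.≟ suc (toℕ v))

-- `colour` is total for convenience: its values on non-adjacent pairs (the
-- diagonal, for a complete graph) are junk, and `colourClass` ignores them.
record EdgeColouring (k : ℕ) {n : ℕ} (H : Graph n) : Set where
  field
    colour     : Fin n → Fin n → Fin k
    colour-sym : ∀ u v → colour u v ≡ colour v u

open EdgeColouring public

colourClass : ∀ {k n} {H : Graph n} → EdgeColouring k H → Fin k → Graph n
colourClass {H = H} c i .Adj u v              = Adj H u v × colour c u v ≡ i
colourClass {H = H} c i .symm {u} {v} (e , p) =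
  symm H e , trans (colour-sym c v u) p
colourClass {H = H} c i .irrefl u≡v (e , _)   = irrefl H u≡v e
colourClass {H = H} c i .adj? u v             =
  adj? H u v ×-dec (colour c u v Fin.≟ i)

-- Subgraph containment, not necessarily induced: edges of G go to edges of H,
-- but non-edges of G are unconstrained.
_⊑_ : ∀ {m n} → Graph m → Graph n → Set
_⊑_ {m} {n} G H = Σ (Fin m → Fin n) λ f →
  Injective _≡_ _≡_ f × (f Preserves Adj G ⟶ Adj H)

Arrows : ∀ {m} → ℕ → Graph m → ℕ → Set
Arrows k G N = (c : EdgeColouring k (complete N)) →
  ∃ λ (i : Fin k) → G ⊑ colourClass c i

-- A relation rather than a function: N is the k-colour diagonal Ramsey number
-- R(G, …, G) of G.
IsRamseyNumber : ∀ {m} → ℕ → Graph m → ℕ → Set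
IsRamseyNumber k G N = Arrows k G N × (∀ M → Arrows k G M → N ≤ M)

{-# OPTIONS --safe #-}
module Submission where

open import Defs
open import Data.Nat using (ℕ; _≤_)
open import Data.Product using (∃-syntax; _×_)
open import Data.Bool using (Bool; T; true; false; _∧_; _∨_; not; if_then_else_)
open import Data.Bool.ListAction using (any)
open import Data.Empty using (⊥; ⊥-elim)
open import Data.Fin as Fin using (Fin; #_; toℕ; fromℕ<)
import Data.Fin.Properties as Fin
open import Data.List using (List; []; _∷_; _++_; map; foldr; length; lookup; allFin; upTo; applyUpTo; replicate; filterᵇ)
open import Data.List.Membership.Propositional.Properties using (∈-lookup)
open import Data.List.Properties using (map-applyUpTo; length-++)
open import Data.List.Relation.Binary.Permutation.Propositional
open import Data.List.Relation.Binary.Permutation.Propositional.Properties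
  using (↭-length; ++⁺; ++⁺ˡ; ++⁺ʳ; shift; ++-identityʳ; ++-assoc; ++-comm; shifts)
import Data.List.Relation.Binary.Permutation.Propositional.Properties as ↭
open import Data.List.Relation.Unary.All as All using (All; []; _∷_)
open import Data.List.Relation.Unary.All.Properties using (++⁻ˡ; ++⁻ʳ)
import Data.List.Relation.Unary.All.Properties as All
open import Data.List.Relation.Unary.AllPairs using (AllPairs; []; _∷_)
open import Data.List.Relation.Unary.Linked using (Linked; []; [-]; _∷_)
import Data.List.Relation.Unary.Linked.Properties as Linked
open import Data.List.Relation.Unary.Unique.Propositional using (Unique)
open import Data.List.Relation.Unary.Unique.Propositional.Properties using (allFin⁺)
open import Data.Maybe as Maybe using (Maybe; just; nothing; _<∣>_)
open import Data.Nat
open import Data.Nat.Properties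
open import Data.Nat.Tactic.RingSolver using (solve-∀)
open import Data.Product using (∃; ∃₂; _,_; proj₁; proj₂)
open import Data.Sum as Sum using (_⊎_; inj₁; inj₂; [_,_]′)
open import Data.Unit using (⊤; tt)
open import Data.Vec as Vec using ([]; _∷_)
open import Function using (_∘_; case_of_)
open import Function.Definitions using (Injective)
open import Relation.Binary.PropositionalEquality using (_≡_; _≢_; refl; sym; cong; cong₂; subst)
import Relation.Binary.PropositionalEquality as ≡
open import Relation.Nullary using (Dec; yes; no)
open import Relation.Nullary.Decidable
  using (True; does; dec-true; dec-false; toWitness; _×-dec_; _⊎-dec_; _→-dec_)

-- One colour class, say red, has at least 46 = 3 · 17 − 5 of the 136 edges, so
-- it is not 3-degenerate. In a P₉-free graph, a component of a subgraph of
-- minimum degree 4 has between 5 and 8 vertices, by Dirac's argument. Removing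
-- vertices of degree at most 3 and such components of order at most 6 either
-- reveals a component of order 7 or 8, or exhausts the graph.
-- * A component of order 7 or 8 leaves so little room for further red edges at it
--   that no red edge joins some 7 vertices to some 9 others, and a K_{7,9} in the
--   two other colours contains a P₉.
-- * Otherwise red arises from a dense 6-vertex graph or from K₅ by adding
--   vertices with (almost) three earlier neighbours each. The former contains a
--   P₉; in the latter all added vertices have the same three neighbours, so 13
--   vertices carry two colours only, one of which has 39 = 3 · 13 edges, and the
--   same analysis applies to that colour.
-- The statements about at most nine vertices are established by a search.

-- Search for Hamiltonian paths

-- The bound of 46 edges alone cannot force a P₉: K₃ joined to the disjoint union of an edge and 12
-- isolated vertices has 17 vertices, exactly 46 edges and no P₉, since removing the vertices of K₃
-- cuts a path into at most four pieces, of which at most one has two vertices. Hence the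
-- exceptional graphs have to be pinned down exactly before a second colour can be used. The
-- accounting is in terms of the deficit 3n - e. A 3-degenerate graph on n ≥ 3 vertices has deficit
-- at least 6, while the dense colour has at most 5. Stripping a vertex of degree at most 3 never
-- raises the deficit, and removing a component of order 5 or 6 lowers it by at least 3. A K₇ has
-- deficit 0, so this saving fails for components of order 7 and 8, and these are treated by
-- connectivity instead.

∧-true : ∀ {x y} → x ∧ y ≡ true → x ≡ true × y ≡ true
∧-true {true} {true} _ = refl , refl

≡ᵇ-sound : ∀ m n → (m ≡ᵇ n) ≡ true → m ≡ n
≡ᵇ-sound m n h = ≡ᵇ⇒≡ m n (subst T (sym h) tt)

bit : Bool → ℕ
bit true  = 1
bit false = 0

count : ∀ {A : Set} → (A → Bool) → List A → ℕ
count P []       = 0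
count P (x ∷ xs) = bit (P x) + count P xs

nth : ∀ {X : Set} → X → ℕ → List X → X
nth d _       []       = d
nth d zero    (x ∷ _)  = x
nth d (suc n) (_ ∷ xs) = nth d n xs

update : ∀ {X : Set} → ℕ → (X → X) → List X → List X
update _       f []       = []
update zero    f (x ∷ xs) = f x ∷ xs
update (suc n) f (x ∷ xs) = x ∷ update n f xs

update-preserves : ∀ {X : Set} {d : X} (P : ℕ → X → Set) {f} j xs →
  (∀ i → P i (nth d i xs)) → (∀ {x} → P j x → P j (f x)) →
  ∀ i → P i (nth d i (update j f xs))
update-preserves P j       []       h hf i       = h i
update-preserves P zero    (x ∷ xs) h hf zero    = hf (h 0)
update-preserves P zero    (x ∷ xs) h hf (suc i) = h (suc i)
update-preserves P (suc j) (x ∷ xs) h hf zero    = h 0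
update-preserves P (suc j) (x ∷ xs) h hf (suc i) =
  update-preserves (P ∘ suc) j xs (h ∘ suc) hf i

delete : ℕ → List ℕ → Maybe (List ℕ)
delete x []       = nothing
delete x (y ∷ ys) = if x ≡ᵇ y then just ys else Maybe.map (y ∷_) (delete x ys)

delete-↭ : ∀ x ys {zs} → delete x ys ≡ just zs → ys ↭ x ∷ zs
delete-↭ x (y ∷ ys) h with x ≡ᵇ y in x≡y
delete-↭ x (y ∷ ys) refl | true rewrite ≡ᵇ-sound x y x≡y = refl
... | false with delete x ys in eq
delete-↭ x (y ∷ ys) refl | false | just zs =
  trans (prep y (delete-↭ x ys eq)) (swap y x refl)

isPermutation : List ℕ → List ℕ → Bool
isPermutation []       []      = true
isPermutation []       (_ ∷ _) = false
isPermutation (x ∷ xs) ys with delete x ys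
... | just zs = isPermutation xs zs
... | nothing = false

isPermutation-↭ : ∀ xs ys → isPermutation xs ys ≡ true → xs ↭ ys
isPermutation-↭ []       []       h = refl
isPermutation-↭ (x ∷ xs) ys       h with delete x ys in eq
... | just zs = trans (prep x (isPermutation-↭ xs zs h)) (↭-sym (delete-↭ x ys eq))

data Status : Set where
  absent unknown present : Status

Matrix : Set
Matrix = List (List Status)

-- Positions out of range read as `unknown`, about which `Agree` asserts nothing, so no index bounds
-- enter the soundness proof.
entry : Matrix → ℕ → ℕ → Status
entry m i j = nth unknown j (nth [] i m)

assign : ℕ → ℕ → Status → Matrix → Matrix
assign i j s m = update i (update j (λ _ → s)) (update j (update i (λ _ → s)) m)

record AtLeast : Set where
  constructor _meets_∣≥_
  field
    vertex : ℕ
    among  : List ℕ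
    bound  : ℕ

isPresent isAvailable isUnknown : Status → Bool
isPresent present = true
isPresent _       = false
isAvailable absent = false
isAvailable _      = true
isUnknown unknown = true
isUnknown _       = false

available : Matrix → ℕ → ℕ → Bool
available m u v = isAvailable (entry m u v)

violated : Matrix → AtLeast → Bool
violated m (u meets vs ∣≥ b) = count (available m u) vs <ᵇ b

-- Untrusted guidance for the search: the edges of a constraint without slack
-- are forced.
saturate : Matrix → AtLeast → Matrix
saturate m (u meets vs ∣≥ b) =
  if count (available m u) vs ≡ᵇ b
  then foldr (λ v m′ → if isUnknown (entry m′ u v) then assign u v present m′ else m′) m vs
  else m

elem : ℕ → List ℕ → Bool
elem u = any (u ≡ᵇ_)

module _ (m : Matrix) where

  mutual
    -- Present edges are tried before unknown ones because `branch` need not split on them, which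
    -- keeps the case tree small. Nothing is proved about this search; its result is rechecked by
    -- `valid` and `branch`.
    extend : ℕ → ℕ → List ℕ → Maybe (List ℕ)
    extend zero    u rest = just (u ∷ [])
    extend (suc n) u rest = Maybe.map (u ∷_) (first n rest
      (filterᵇ (λ v → isPresent (entry m u v)) rest ++ filterᵇ (λ v → isUnknown (entry m u v)) rest))

    first : ℕ → List ℕ → List ℕ → Maybe (List ℕ)
    first n rest []       = nothing
    first n rest (v ∷ vs) =
      extend n v (filterᵇ (λ w → not (w ≡ᵇ v)) rest) <∣> first n rest vs

record Problem : Set where
  constructor problem
  field
    order       : ℕ
    starts      : List ℕ
    constraints : List AtLeast

-- The graph of order `order` is only known through lower bounds on degrees.
-- Propose a Hamiltonian path without absent edges: if it is not a path of the
-- graph, then one of its edges is absent, and enough absent edges violate a bound.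
module Solver (P : Problem) where
  open Problem P

  candidate : Matrix → Maybe (List ℕ)
  candidate m with order
  ... | zero  = nothing
  ... | suc k = first (foldr (λ c m′ → saturate m′ c) m constraints) k (upTo (suc k)) starts

  touching : ℕ → ℕ → AtLeast → Bool
  touching i j (u meets _ ∣≥ _) = (u ≡ᵇ i) ∨ (u ≡ᵇ j)

  valid : List ℕ → Bool
  valid []      = false
  valid (u ∷ p) = elem u starts ∧ isPermutation (u ∷ p) (upTo order)

  mutual
    solve : ℕ → Matrix → Bool
    solve zero       m = false
    solve (suc fuel) m with candidate m
    ... | nothing = false
    ... | just p  = valid p ∧ branch fuel m p

    -- The cases are distinguished by the first absent edge of the proposed path: when an edge is
    -- assumed absent, all earlier ones are already marked present.
    branch : ℕ → Matrix → List ℕ → Bool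
    branch fuel m []          = true
    branch fuel m (i ∷ [])    = true
    branch fuel m (i ∷ j ∷ p) =
      if isPresent (entry m i j)
      then branch fuel m (j ∷ p)
      else (refute fuel i j (assign i j absent m) ∧ branch fuel (assign i j present m) (j ∷ p))

    refute : ℕ → ℕ → ℕ → Matrix → Bool
    refute fuel i j m = any (violated m) (filterᵇ (touching i j) constraints) ∨ solve fuel m

  blank : Matrix
  blank = foldr (λ i → assign i i absent) (replicate order (replicate order unknown)) (upTo order)

  solved : Bool
  -- Each nested call of `solve` comes after one more pair is marked absent. No problem below has
  -- more than nine vertices, hence more than 36 pairs, so the fuel does not run out.
  solved = solve 40 blank

-- Soundness of the search

Holds : (ℕ → ℕ → Bool) → AtLeast → Set
Holds E (u meets vs ∣≥ b) = b ≤ count (E u) vs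

Adjacent : ∀ {A : Set} → (A → A → Bool) → A → A → Set
Adjacent r x y = r x y ≡ true

Agree : Status → Bool → Set
Agree absent  e = e ≡ false
Agree unknown e = ⊤
Agree present e = e ≡ true

nth-replicate : ∀ {X : Set} (P : X → Set) {d x} i n → P d → P x → P (nth d i (replicate n x))
nth-replicate P i       zero    pd px = pd
nth-replicate P zero    (suc n) pd px = px
nth-replicate P (suc i) (suc n) pd px = nth-replicate P i n pd px

if-present : ∀ s {e x y} → Agree s e → (if isPresent s then x else y) ≡ true →
  (e ≡ true × x ≡ true) ⊎ y ≡ true
if-present absent  _ h = inj₂ h
if-present unknown _ h = inj₂ h
if-present present e h = inj₁ (e , h)

bool-cases : ∀ {X : Set} b → (b ≡ true → X) → (b ≡ false → X) → X
bool-cases true  f g = f refl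
bool-cases false f g = g refl

∨-split : ∀ {x y} → x ∨ y ≡ true → x ≡ true ⊎ y ≡ true
∨-split {true}  _ = inj₁ refl
∨-split {false} h = inj₂ h

any-filter : ∀ {A : Set} {P Q : A → Bool} xs → any P (filterᵇ Q xs) ≡ true →
  ∀ {R : A → Set} → All R xs → ∃ λ x → P x ≡ true × R x
any-filter {P = P} {Q} (x ∷ xs) h (px ∷ pxs) with Q x
... | false = any-filter xs h pxs
... | true with P x in eq
...   | true  = x , eq , px
...   | false = any-filter xs h pxs

module Soundness (P : Problem) (E : ℕ → ℕ → Bool)
  (E-sym : ∀ i j → E i j ≡ E j i) (E-irrefl : ∀ i → E i i ≡ false) where
  open Problem P
  open Solver P

  Describes : Matrix → Set
  Describes m = ∀ i j → Agree (entry m i j) (E i j)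

  assign-describes : ∀ i j s m → Agree s (E i j) → Describes m → Describes (assign i j s m)
  assign-describes i j s m h inv =
    update-preserves RowAgrees i (update j (update i (λ _ → s)) m)
      (update-preserves RowAgrees j m inv
        (λ {row} h′ → update-preserves (EntryAgrees j) i row h′ (λ _ → subst (Agree s) (E-sym i j) h)))
      (λ {row} h′ → update-preserves (EntryAgrees i) j row h′ (λ _ → h))
    where
    EntryAgrees : ℕ → ℕ → Status → Set
    EntryAgrees a b x = Agree x (E a b)
    RowAgrees : ℕ → List Status → Set
    RowAgrees a row = ∀ b → EntryAgrees a b (nth unknown b row)

  count-available : ∀ m → Describes m → ∀ u vs → count (E u) vs ≤ count (available m u) vs
  count-available m inv u []       = z≤n
  count-available m inv u (v ∷ vs) = +-mono-≤ (lemma (entry m u v) (inv u v)) (count-available m inv u vs)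
    where
    lemma : ∀ s {e} → Agree s e → bit e ≤ bit (isAvailable s)
    lemma absent  refl       = z≤n
    lemma unknown {true}  _  = ≤-refl
    lemma unknown {false} _  = z≤n
    lemma present refl       = ≤-refl

  violated-sound : ∀ m → Describes m → ∀ c → violated m c ≡ true → Holds E c → ⊥
  violated-sound m inv (u meets vs ∣≥ b) h holds =
    <⇒≱ (<ᵇ⇒< _ b (subst T (sym h) tt)) (≤-trans holds (count-available m inv u vs))

  Solution : Set
  Solution = ∃₂ λ u p → elem u starts ≡ true × (u ∷ p ↭ upTo order) × Linked (Adjacent E) (u ∷ p)

  valid-sound : ∀ p → valid p ≡ true → Linked (Adjacent E) p → Solution
  valid-sound (u ∷ p) h l =
    let h₁ , h₂ = ∧-true h in u , p , h₁ , isPermutation-↭ (u ∷ p) (upTo order) h₂ , l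

  module _ (holds : All (Holds E) constraints) where

    mutual
      solve-sound : ∀ fuel m → Describes m → solve fuel m ≡ true → Solution
      solve-sound (suc fuel) m inv h with candidate m
      ... | just p with ∧-true {valid p} h
      ...   | hv , hb with branch-sound fuel m p inv hb
      ...     | inj₁ l = valid-sound p hv l
      ...     | inj₂ s = s

      branch-sound : ∀ fuel m p → Describes m → branch fuel m p ≡ true →
        Linked (Adjacent E) p ⊎ Solution
      branch-sound fuel m []          inv h = inj₁ []
      branch-sound fuel m (i ∷ [])    inv h = inj₁ [-]
      branch-sound fuel m (i ∷ j ∷ p) inv h = [ (λ (eij , h′) → link eij (branch-sound fuel m (j ∷ p) inv h′))
        , (λ h′ → bool-cases (E i j)
            (λ eij → link eij (branch-sound fuel (assign i j present m) (j ∷ p)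
              (assign-describes i j present m eij inv) (proj₂ (∧-true {refute fuel i j (assign i j absent m)} h′))))
            (λ eij → inj₂ (refute-sound fuel i j (assign i j absent m)
              (assign-describes i j absent m eij inv) (proj₁ (∧-true h′))))) ]′
        (if-present (entry m i j) (inv i j) h)

      link : ∀ {i j p} → E i j ≡ true → Linked (Adjacent E) (j ∷ p) ⊎ Solution →
        Linked (Adjacent E) (i ∷ j ∷ p) ⊎ Solution
      link eij (inj₁ l) = inj₁ (eij ∷ l)
      link eij (inj₂ s) = inj₂ s

      refute-sound : ∀ fuel i j m → Describes m → refute fuel i j m ≡ true → Solution
      refute-sound fuel i j m inv h with ∨-split h
      ... | inj₂ hs = solve-sound fuel m inv hs
      ... | inj₁ hv with any-filter constraints hv holds
      ...   | c , hc , hold = ⊥-elim (violated-sound m inv c hc hold)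

    blank-describes : Describes blank
    blank-describes = go (upTo order)
      where
      start : List ℕ → Matrix
      start = foldr (λ i → assign i i absent) (replicate order (replicate order unknown))
      go : ∀ is → Describes (start is)
      go []       i j = nth-replicate (λ row → Agree (nth unknown j row) (E i j)) i order tt
        (nth-replicate (λ s → Agree s (E i j)) j order tt tt)
      go (i ∷ is) = assign-describes i i absent (start is) (E-irrefl i) (go is)

    solved-sound : solved ≡ true → Solution
    solved-sound = solve-sound 40 blank blank-describes

-- As a record, `Solved P` determines `P` by unification; the bare equation would not, because
-- `Solver.solved P` reduces.
record Solved (P : Problem) : Set where
  constructor by-search
  field
    succeeds : Solver.solved P ≡ true

-- Counting in lists up to permutation

bit≤1 : ∀ b → bit b ≤ 1
bit≤1 true  = ≤-refl
bit≤1 false = z≤n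

module _ {A : Set} where

  search : (P : A → Bool) (xs : List A) →
    (∃₂ λ x ys → xs ↭ x ∷ ys × P x ≡ true) ⊎ All (λ x → P x ≡ false) xs
  search P []       = inj₂ []
  search P (x ∷ xs) with P x in eq
  ... | true  = inj₁ (x , xs , refl , eq)
  ... | false with search P xs
  ...   | inj₁ (y , ys , σ , py) = inj₁ (y , x ∷ ys , trans (prep x σ) (swap x y refl) , py)
  ...   | inj₂ none = inj₂ (eq ∷ none)

  each : ∀ {B : Set} {Q : A → Set} xs →
    (∀ {x ys} → xs ↭ x ∷ ys → B ⊎ Q x) → B ⊎ All Q xs
  each []       f = inj₂ []
  each (x ∷ xs) f with f refl
  ... | inj₁ b = inj₁ b
  ... | inj₂ q = Sum.map₂ (q ∷_) (each xs (λ {y} σ → f (trans (prep x σ) (swap x y refl))))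

  separate : (P : A → Bool) (xs : List A) →
    ∃₂ λ ys zs → xs ↭ ys ++ zs × All (λ x → P x ≡ true) ys × All (λ x → P x ≡ false) zs
  separate P []       = [] , [] , refl , [] , []
  separate P (x ∷ xs) with separate P xs | P x in eq
  ... | ys , zs , σ , py , pz | true  = x ∷ ys , zs , prep x σ , eq ∷ py , pz
  ... | ys , zs , σ , py , pz | false =
    ys , x ∷ zs , trans (prep x σ) (↭-sym (shift x ys zs)) , py , eq ∷ pz

  count-↭ : ∀ (P : A → Bool) {xs ys} → xs ↭ ys → count P xs ≡ count P ys
  count-↭ P refl         = refl
  count-↭ P (prep x σ)   = cong (bit (P x) +_) (count-↭ P σ)
  count-↭ P (swap {xs} {ys} x y σ) = ≡.trans (swapped (bit (P x)) (bit (P y)) (count P xs))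
    (cong (λ n → bit (P y) + (bit (P x) + n)) (count-↭ P σ))
    where
    swapped : ∀ a b c → a + (b + c) ≡ b + (a + c)
    swapped = solve-∀
  count-↭ P (trans σ τ)  = ≡.trans (count-↭ P σ) (count-↭ P τ)

  count-++ : ∀ (P : A → Bool) xs ys → count P (xs ++ ys) ≡ count P xs + count P ys
  count-++ P []       ys = refl
  count-++ P (x ∷ xs) ys = ≡.trans (cong (bit (P x) +_) (count-++ P xs ys)) (sym (+-assoc (bit (P x)) _ _))

  count≤length : ∀ (P : A → Bool) xs → count P xs ≤ length xs
  count≤length P []       = z≤n
  count≤length P (x ∷ xs) = +-mono-≤ (bit≤1 (P x)) (count≤length P xs)

  count-none : ∀ {P : A → Bool} {xs} → All (λ x → P x ≡ false) xs → count P xs ≡ 0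
  count-none []         = refl
  count-none (px ∷ pxs) rewrite px = count-none pxs

  count-zero : ∀ {P : A → Bool} xs → count P xs ≡ 0 → All (λ x → P x ≡ false) xs
  count-zero []       h = []
  count-zero {P} (x ∷ xs) h with P x in eq
  ... | false = eq ∷ count-zero xs h

  pick : ∀ {P : A → Bool} {n} xs → suc n ≤ count P xs →
    ∃₂ λ x ys → xs ↭ x ∷ ys × P x ≡ true × n ≤ count P ys
  pick {P} (x ∷ xs) h with P x in eq
  ... | true  = x , xs , refl , eq , ≤-pred h
  ... | false with pick xs h
  ...   | y , ys , σ , py , k = y , x ∷ ys , trans (prep x σ) (swap x y refl) , py ,
    subst (λ b → _ ≤ bit b + count P ys) (sym eq) k

  nth-upTo : ∀ {d : A} xs → map (λ i → nth d i xs) (upTo (length xs)) ≡ xs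
  nth-upTo {d} xs = ≡.trans (map-applyUpTo _ _ (length xs)) (go xs)
    where
    go : ∀ xs → applyUpTo (λ i → nth d i xs) (length xs) ≡ xs
    go []       = refl
    go (x ∷ xs) = cong (x ∷_) (go xs)

  any-nth : ∀ {d : A} {P : A → Bool} xs → any P xs ≡ true →
    ∃ λ i → i < length xs × P (nth d i xs) ≡ true
  any-nth {P = P} (x ∷ xs) h with P x in eq
  ... | true  = 0 , z<s , eq
  ... | false = let i , i< , pi = any-nth xs h in suc i , s<s i< , pi

  any-none : ∀ {P : A → Bool} xs → any P xs ≡ false → All (λ x → P x ≡ false) xs
  any-none []       h = []
  any-none {P} (x ∷ xs) h with P x in eq
  ... | false = eq ∷ any-none xs h

  lastOf : A → List A → A
  lastOf x []       = x
  lastOf x (y ∷ ys) = lastOf y ys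

-- The binomial coefficient n choose 2, the number of edges of a complete graph on n vertices.
tri : ℕ → ℕ
tri zero    = 0
tri (suc n) = n + tri n

-- Finite cases

range : ℕ → ℕ → List ℕ
range a n = map (a +_) (upTo n)

neighbours : ℕ → List ℕ → List AtLeast
neighbours u = map (λ v → u meets (v ∷ []) ∣≥ 1)

degrees : List ℕ → ℕ → List ℕ → List AtLeast
degrees us b vs = map (λ u → u meets vs ∣≥ b) us

pathFrom : ℕ → ℕ → List AtLeast
pathFrom i zero    = []
pathFrom i (suc n) = neighbours i (suc i ∷ []) ++ pathFrom (suc i) n

below : (ℕ → Bool) → ℕ → Bool
below f zero    = true
below f (suc n) = f n ∧ below f n

below-sound : ∀ f {n i} → below f n ≡ true → i < n → f i ≡ true
below-sound f {suc n} {i} h i<n with ∧-true {f n} h | m≤n⇒m<n∨m≡n (≤-pred i<n)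
... | fn , _ | inj₂ refl = fn
... | _  , b | inj₁ i<   = below-sound f b i<

-- Vertices 1, …, s form a path whose ends have four neighbours on it, and the
-- extra vertex 0 is adjacent to vertex i + 1.
absorbing : ℕ → ℕ → Problem
absorbing s i = problem (suc s) (upTo (suc s))
  (neighbours 0 (suc i ∷ []) ++ pathFrom 1 (s ∸ 1) ++ degrees (1 ∷ s ∷ []) 4 (range 1 s))

-- This is Dirac's closing step: the degrees of the two ends sum to 8 ≥ s, so crossing chords turn
-- the path into a Hamiltonian cycle, which can be opened next to the neighbour of 0.
absorbing-solved : ∀ {s i} → 5 ≤ s → s ≤ 8 → i < s → Solved (absorbing s i)
absorbing-solved {1} (s≤s ())
absorbing-solved {2} (s≤s (s≤s ()))
absorbing-solved {3} (s≤s (s≤s (s≤s ())))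
absorbing-solved {4} (s≤s (s≤s (s≤s (s≤s ()))))
absorbing-solved {5} _ _ i< = by-search (below-sound (λ i → Solver.solved (absorbing 5 i)) refl i<)
absorbing-solved {6} _ _ i< = by-search (below-sound (λ i → Solver.solved (absorbing 6 i)) refl i<)
absorbing-solved {7} _ _ i< = by-search (below-sound (λ i → Solver.solved (absorbing 7 i)) refl i<)
absorbing-solved {8} _ _ i< = by-search (below-sound (λ i → Solver.solved (absorbing 8 i)) refl i<)
absorbing-solved {suc (suc (suc (suc (suc (suc (suc (suc (suc s))))))))} _ (s≤s (s≤s (s≤s (s≤s (s≤s (s≤s (s≤s (s≤s ()))))))))

-- Vertices 2, …, 8 have four neighbours among themselves.
pendants : Problem
pendants = problem 9 (upTo 9)
  (neighbours 0 (2 ∷ []) ++ neighbours 1 (3 ∷ []) ++ degrees (range 2 7) 4 (range 2 7))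

-- By Ore's criterion seven vertices of minimum degree (7 + 1) / 2 form a Hamilton-connected graph,
-- so some path from 2 to 3 covers all seven.
pendants-solved : Solved pendants
pendants-solved = by-search refl

tail : Problem
tail = problem 9 (upTo 9)
  (neighbours 0 (1 ∷ []) ++ neighbours 1 (2 ∷ []) ++ degrees (range 2 7) 4 (range 2 7))

-- By Dirac's theorem the seven vertices carry a Hamiltonian cycle; it is opened at 2, where 1 and 0
-- are appended.
tail-solved : Solved tail
tail-solved = by-search refl

-- The prescribed start makes a chosen neighbour of the first added vertex an end of the Hamiltonian
-- path, which is the role of vertex 3 in `sixPlus`.
sixFrom : Problem
sixFrom = problem 6 (0 ∷ []) (degrees (upTo 6) 4 (upTo 6))

sixFrom-solved : Solved sixFrom
sixFrom-solved = by-search refl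

-- Vertices 3, …, 8 form a path with minimum degree four, and x, y, z are added
-- in this order, each with a prescribed number of earlier neighbours. The
-- labelling only matters for the size of the search, which is small when 0 is
-- the vertex with the fewest neighbours.
sixPlus : (x y z a b c : ℕ) → Problem
sixPlus x y z a b c = problem 9 (upTo 9)
  (neighbours x (3 ∷ []) ++ degrees (x ∷ []) a (range 3 6) ++ degrees (y ∷ []) b (x ∷ range 3 6) ++
   degrees (z ∷ []) c (y ∷ x ∷ range 3 6) ++ pathFrom 3 5 ++ degrees (range 3 6) 4 (range 3 6))

sixPlus-solved : Solved (sixPlus 2 1 0 3 3 1) × Solved (sixPlus 2 0 1 3 1 3) × Solved (sixPlus 0 2 1 1 3 3) ×
  Solved (sixPlus 2 1 0 3 2 2) × Solved (sixPlus 1 2 0 2 3 2) × Solved (sixPlus 1 0 2 2 2 3)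
sixPlus-solved = by-search refl , by-search refl , by-search refl , by-search refl , by-search refl , by-search refl

clique : List ℕ → List AtLeast
clique []       = []
clique (v ∷ vs) = neighbours v vs ++ clique vs

-- Vertices 4, …, 8 form a clique to which 3, 2, 1 and 0 are added with three
-- earlier neighbours each; 3 is adjacent to 4, 5 and 6.
secondAdded thirdAdded : List ℕ → Problem
secondAdded vs = problem 9 (upTo 9)
  (degrees (0 ∷ []) 3 (range 1 8) ++ degrees (1 ∷ []) 3 (range 2 7) ++ degrees (2 ∷ []) 3 vs ++
   neighbours 3 (range 4 3) ++ clique (range 4 5))
thirdAdded vs = problem 9 (upTo 9)
  (degrees (0 ∷ []) 3 (range 1 8) ++ degrees (1 ∷ []) 3 vs ++ neighbours 2 (range 4 3) ++
   neighbours 3 (range 4 3) ++ clique (range 4 5))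

-- The three lists omit 4, 5 and 6 in turn: without a P₉, vertex 2 cannot miss any of the clique
-- neighbours of 3.
secondAdded-solved : Solved (secondAdded (3 ∷ 5 ∷ 6 ∷ 7 ∷ 8 ∷ [])) ×
  Solved (secondAdded (3 ∷ 4 ∷ 6 ∷ 7 ∷ 8 ∷ [])) × Solved (secondAdded (3 ∷ 4 ∷ 5 ∷ 7 ∷ 8 ∷ []))
secondAdded-solved = by-search refl , by-search refl , by-search refl

-- Likewise, once 2 and 3 are both adjacent to 4, 5 and 6, vertex 1 cannot miss any of these three.
thirdAdded-solved : Solved (thirdAdded (2 ∷ 3 ∷ 5 ∷ 6 ∷ 7 ∷ 8 ∷ [])) ×
  Solved (thirdAdded (2 ∷ 3 ∷ 4 ∷ 6 ∷ 7 ∷ 8 ∷ [])) × Solved (thirdAdded (2 ∷ 3 ∷ 4 ∷ 5 ∷ 7 ∷ 8 ∷ []))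
thirdAdded-solved = by-search refl , by-search refl , by-search refl

-- Paths on nine vertices in dense graphs

module SimpleGraph {A : Set} (r : A → A → Bool)
  (r-sym : ∀ x y → r x y ≡ r y x) (r-irrefl : ∀ x → r x x ≡ false) where

  adjacent-sym : ∀ {x y} → r x y ≡ true → r y x ≡ true
  adjacent-sym {x} {y} h = ≡.trans (r-sym y x) h

  deg : A → List A → ℕ
  deg x = count (r x)

  edges : List A → ℕ
  edges []       = 0
  edges (x ∷ xs) = deg x xs + edges xs

  deg-self : ∀ x xs → deg x (x ∷ xs) ≡ deg x xs
  deg-self x xs = cong (λ b → bit b + deg x xs) (r-irrefl x)

  edges-↭ : ∀ {xs ys} → xs ↭ ys → edges xs ≡ edges ys
  edges-↭ refl        = refl
  edges-↭ (prep x σ)  = cong₂ _+_ (count-↭ (r x) σ) (edges-↭ σ)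
  edges-↭ (swap {xs} {ys} x y σ) rewrite r-sym x y | count-↭ (r x) σ | count-↭ (r y) σ | edges-↭ σ =
    swapped (bit (r y x)) (deg x ys) (deg y ys) (edges ys)
    where
    swapped : ∀ b d d′ e → b + d + (d′ + e) ≡ b + d′ + (d + e)
    swapped = solve-∀
  edges-↭ (trans σ τ) = ≡.trans (edges-↭ σ) (edges-↭ τ)

  edges≤tri : ∀ xs → edges xs ≤ tri (length xs)
  edges≤tri []       = z≤n
  edges≤tri (x ∷ xs) = +-mono-≤ (count≤length (r x) xs) (edges≤tri xs)

  NoEdges : List A → List A → Set
  NoEdges xs ys = All (λ x → All (λ y → r x y ≡ false) ys) xs

  noEdges-deg : ∀ {x} xs {ys} → All (λ y → r x y ≡ false) ys → deg x (xs ++ ys) ≡ deg x xs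
  noEdges-deg {x} xs {ys} h = ≡.trans (count-++ (r x) xs ys)
    (≡.trans (cong (deg x xs +_) (count-none h)) (+-identityʳ _))

  edges-++ : ∀ {xs ys} → NoEdges xs ys → edges (xs ++ ys) ≡ edges xs + edges ys
  edges-++ {[]}     []       = refl
  edges-++ {x ∷ xs} (h ∷ hs) = ≡.trans (cong₂ _+_ (noEdges-deg xs h) (edges-++ hs))
    (sym (+-assoc (deg x xs) _ _))

  -- The list `q` of remaining vertices makes `p` a sub-multiset of `xs`. Distinctness of the
  -- vertices is required only later, when colours are compared and the path is embedded.
  HasPath : List A → Set
  HasPath xs = ∃₂ λ p q → p ++ q ↭ xs × Linked (Adjacent r) p × length p ≡ 9

  spanning : ∀ {xs p} → p ↭ xs → Linked (Adjacent r) p → length xs ≡ 9 → HasPath xs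
  spanning {p = p} σ l h = p , [] , trans (++-identityʳ p) σ , l , ≡.trans (↭-length σ) h

  hasPath-⊆ : ∀ {xs ys zs} → zs ↭ xs ++ ys → HasPath xs → HasPath zs
  hasPath-⊆ {ys = ys} τ (p , q , σ , l , h) =
    p , q ++ ys , trans (↭-sym (++-assoc p q ys)) (trans (++⁺ σ refl) (↭-sym τ)) , l , h

  record Solution (P : Problem) (v : A) (vs : List A) : Set where
    constructor found
    field
      {start} : ℕ
      {rest}  : List A
      allowed : elem start (Problem.starts P) ≡ true
      spans   : nth v start (v ∷ vs) ∷ rest ↭ v ∷ vs
      linked  : Linked (Adjacent r) (nth v start (v ∷ vs) ∷ rest)

  -- The labels of the problem are positions in `v ∷ vs`. Positions beyond the end denote `v`, so
  -- the relation on all of ℕ stays symmetric and irreflexive.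
  solution : ∀ {P} v vs → Solved P → suc (length vs) ≡ Problem.order P →
    All (Holds λ i j → r (nth v i (v ∷ vs)) (nth v j (v ∷ vs))) (Problem.constraints P) → Solution P v vs
  solution {problem .(suc (length vs)) starts cs} v vs (by-search s) refl holds =
    let u , p , hu , σ , l = Soundness.solved-sound (problem _ starts cs)
          (λ i j → r (at i) (at j)) (λ i j → r-sym _ _) (λ i → r-irrefl _) holds s
    in found {start = u} hu (trans (↭.map⁺ at σ) (↭-reflexive (nth-upTo (v ∷ vs)))) (Linked.map⁺ l)
    where
    at : ℕ → A
    at i = nth v i (v ∷ vs)

  rearranged : ∀ {P v vs} → Solution P v vs → ∃ λ p → p ↭ v ∷ vs × Linked (Adjacent r) p
  rearranged (found _ σ l) = _ , σ , l

  edge : ∀ {x y} → r x y ≡ true → 1 ≤ bit (r x y) + 0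
  edge h rewrite h = ≤-refl

  open ≤-Reasoning

  -- Components of minimum degree four, by Dirac's argument

  Path : List A → Set
  Path = Linked (Adjacent r)

  absorb : ∀ {x p y} → 5 ≤ suc (length p) → suc (length p) ≤ 8 → Path (x ∷ p) →
    4 ≤ deg x (x ∷ p) → 4 ≤ deg (lastOf x p) (x ∷ p) → any (r y) (x ∷ p) ≡ true →
    ∃ λ q → q ↭ y ∷ x ∷ p × Path q
  absorb {x} {p} {y} ≥5 ≤8 l d d′ h with any-nth {d = y} (x ∷ p) h
  ... | i , i< , yi = conclude p ≥5 ≤8 (edge yi) l d d′ (absorbing-solved ≥5 ≤8 i<)
    where
    conclude : ∀ p → 5 ≤ suc (length p) → suc (length p) ≤ 8 →
      1 ≤ bit (r y (nth y i (x ∷ p))) + 0 → Path (x ∷ p) →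
      4 ≤ deg x (x ∷ p) → 4 ≤ deg (lastOf x p) (x ∷ p) →
      Solved (absorbing (suc (length p)) i) → ∃ λ q → q ↭ y ∷ x ∷ p × Path q
    conclude []                (s≤s ())
    conclude (_ ∷ [])          (s≤s (s≤s ()))
    conclude (_ ∷ _ ∷ [])      (s≤s (s≤s (s≤s ())))
    conclude (_ ∷ _ ∷ _ ∷ [])  (s≤s (s≤s (s≤s (s≤s ()))))
    conclude p@(_ ∷ _ ∷ _ ∷ _ ∷ []) _ _ e (a ∷ b ∷ c ∷ f ∷ [-]) d d′ s =
      rearranged (solution y (x ∷ p) s refl
        (e ∷ edge a ∷ edge b ∷ edge c ∷ edge f ∷ d ∷ d′ ∷ []))
    conclude p@(_ ∷ _ ∷ _ ∷ _ ∷ _ ∷ []) _ _ e (a ∷ b ∷ c ∷ f ∷ g ∷ [-]) d d′ s =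
      rearranged (solution y (x ∷ p) s refl
        (e ∷ edge a ∷ edge b ∷ edge c ∷ edge f ∷ edge g ∷ d ∷ d′ ∷ []))
    conclude p@(_ ∷ _ ∷ _ ∷ _ ∷ _ ∷ _ ∷ []) _ _ e (a ∷ b ∷ c ∷ f ∷ g ∷ h ∷ [-]) d d′ s =
      rearranged (solution y (x ∷ p) s refl
        (e ∷ edge a ∷ edge b ∷ edge c ∷ edge f ∷ edge g ∷ edge h ∷ d ∷ d′ ∷ []))
    conclude p@(_ ∷ _ ∷ _ ∷ _ ∷ _ ∷ _ ∷ _ ∷ []) _ _ e (a ∷ b ∷ c ∷ f ∷ g ∷ h ∷ k ∷ [-]) d d′ s =
      rearranged (solution y (x ∷ p) s refl
        (e ∷ edge a ∷ edge b ∷ edge c ∷ edge f ∷ edge g ∷ edge h ∷ edge k ∷ d ∷ d′ ∷ []))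
    conclude (_ ∷ _ ∷ _ ∷ _ ∷ _ ∷ _ ∷ _ ∷ _ ∷ _) _
      (s≤s (s≤s (s≤s (s≤s (s≤s (s≤s (s≤s (s≤s ()))))))))

  -- The list enumerates the vertices along a Hamiltonian path, so that `absorb` applies to it
  -- directly.
  record Core (p : List A) : Set where
    constructor core
    field
      linked  : Path p
      minDeg  : All (λ x → 4 ≤ deg x p) p
      atLeast : 5 ≤ length p
      atMost  : length p ≤ 8

  reversal : ∀ {x p} → Path (x ∷ p) → ∃ λ q → lastOf x p ∷ q ↭ x ∷ p × Path (lastOf x p ∷ q)
  reversal {x} {p} l with go p l [-] refl
    where
    go : ∀ {x acc xs} p → Path (x ∷ p) → Path (x ∷ acc) → x ∷ p ++ acc ↭ xs →
      ∃ λ q → lastOf x p ∷ q ↭ xs × Path (lastOf x p ∷ q)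
    go []          l       k σ = _ , σ , k
    go {x} {acc} (y ∷ p) (e ∷ l) k σ =
      go p l (adjacent-sym e ∷ k) (trans (prep y (shift x p acc)) (trans (swap y x refl) σ))
  ... | q , σ , k = q , trans σ (prep x (++-identityʳ p)) , k

  noEdges-swap : ∀ {p q} → All (λ y → any (r y) p ≡ false) q → NoEdges p q
  noEdges-swap {[]}    h = []
  noEdges-swap {x ∷ p} h =
    All.map (λ {y} h′ → ≡.trans (r-sym x y) (All.head (any-none (x ∷ p) h′))) h ∷
    noEdges-swap (All.map (λ {y} → tail-none y) h)
    where
    tail-none : ∀ y → any (r y) (x ∷ p) ≡ false → any (r y) p ≡ false
    tail-none y h with r y x
    ... | false = h

  module _ {H : List A} (minDegree : All (λ x → 4 ≤ deg x H) H) where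

    CoreIn : Set
    CoreIn = ∃₂ λ p q → H ↭ p ++ q × Core p × NoEdges p q

    inside : ∀ {x p q} → H ↭ p ++ q → 4 ≤ deg x H → All (λ y → r x y ≡ false) q → 4 ≤ deg x p
    inside {x} {p} σ d h =
      subst (4 ≤_) (≡.trans (count-↭ (r x) σ) (noEdges-deg p h)) d

    -- Here `n` is the number of vertices still lacking from nine. If neither end has a neighbour
    -- outside the path, both have all their neighbours on it, so any outside vertex adjacent to the
    -- path can be absorbed; if there is none, the path spans a component.
    grow : ∀ n {x p q} → n + suc (length p) ≡ 9 → H ↭ x ∷ p ++ q → Path (x ∷ p) → HasPath H ⊎ CoreIn
    grow zero    h σ l = inj₁ (_ , _ , ↭-sym σ , l , h)
    grow (suc n) {x} {p} {q} h σ l = stuck-at-head (search (r x) q)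
      where
      ≤8 : suc (length p) ≤ 8
      ≤8 = m+n≤o⇒n≤o n (≤-reflexive (cong pred h))
      larger : ∀ {y p′ q′} → q ↭ y ∷ q′ → p′ ↭ y ∷ x ∷ p → Path p′ → HasPath H ⊎ CoreIn
      larger {p′ = []} τ ρ l′ = case ↭-length ρ of λ ()
      larger {y} {x′ ∷ p′} {q′} τ ρ l′ = grow n
        (≡.trans (cong (n +_) (↭-length ρ)) (≡.trans (+-suc n _) h))
        (trans σ (trans (++⁺ˡ (x ∷ p) τ) (trans (shift y (x ∷ p) q′) (++⁺ʳ q′ (↭-sym ρ))))) l′
      degrees-in : ∀ {z} → 4 ≤ deg z H → All (λ y → r z y ≡ false) q → 4 ≤ deg z (x ∷ p)
      degrees-in = inside σ
      minDegree′ : All (λ z → 4 ≤ deg z H) ((x ∷ p) ++ q)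
      minDegree′ = ↭.All-resp-↭ σ minDegree
      last-degree : ∀ {z} p → All (λ z → 4 ≤ deg z H) (z ∷ p ++ q) → 4 ≤ deg (lastOf z p) H
      last-degree []      (d ∷ _)  = d
      last-degree (_ ∷ p) (_ ∷ ds) = last-degree p ds
      stuck-at-both : All (λ y → r x y ≡ false) q → All (λ y → r (lastOf x p) y ≡ false) q →
        (∃₂ λ y q′ → q ↭ y ∷ q′ × any (r y) (x ∷ p) ≡ true) ⊎ All (λ y → any (r y) (x ∷ p) ≡ false) q →
        HasPath H ⊎ CoreIn
      stuck-at-both hx hl s = conclude s
        where
        dx : 4 ≤ deg x (x ∷ p)
        dx = degrees-in (All.head minDegree′) hx
        ≥5 : 5 ≤ suc (length p)
        ≥5 = s≤s (≤-trans (subst (4 ≤_) (deg-self x p) dx) (count≤length (r x) p))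
        conclude : (∃₂ λ y q′ → q ↭ y ∷ q′ × any (r y) (x ∷ p) ≡ true) ⊎ All (λ y → any (r y) (x ∷ p) ≡ false) q →
          HasPath H ⊎ CoreIn
        conclude (inj₁ (y , q′ , τ , e)) =
          let p′ , ρ , l′ = absorb ≥5 ≤8 l dx (degrees-in (last-degree p minDegree′) hl) e
          in larger τ ρ l′
        conclude (inj₂ none) =
          inj₂ (x ∷ p , q , σ , core l
            (minDegs (x ∷ p) minDegree′ (noEdges-swap none)) ≥5 ≤8 , noEdges-swap none)
          where
          minDegs : ∀ ys → All (λ z → 4 ≤ deg z H) (ys ++ q) → NoEdges ys q → All (λ z → 4 ≤ deg z (x ∷ p)) ys
          minDegs []       _        []       = []
          minDegs (y ∷ ys) (d ∷ ds) (h ∷ hs) = degrees-in d h ∷ minDegs ys ds hs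
      stuck-at-last : All (λ y → r x y ≡ false) q →
        (∃₂ λ y q′ → q ↭ y ∷ q′ × r (lastOf x p) y ≡ true) ⊎ All (λ y → r (lastOf x p) y ≡ false) q →
        HasPath H ⊎ CoreIn
      stuck-at-last hx (inj₁ (y , q′ , τ , e)) =
        let p′ , ρ , l′ = reversal l in larger τ (prep y ρ) (adjacent-sym e ∷ l′)
      stuck-at-last hx (inj₂ hl) = stuck-at-both hx hl (search (λ y → any (r y) (x ∷ p)) q)
      stuck-at-head : (∃₂ λ y q′ → q ↭ y ∷ q′ × r x y ≡ true) ⊎ All (λ y → r x y ≡ false) q →
        HasPath H ⊎ CoreIn
      stuck-at-head (inj₁ (y , q′ , τ , e)) = larger τ refl (adjacent-sym e ∷ l)
      stuck-at-head (inj₂ hx) = stuck-at-last hx (search (r (lastOf x p)) q)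

  find-core : ∀ x H → All (λ y → 4 ≤ deg y (x ∷ H)) (x ∷ H) →
    HasPath (x ∷ H) ⊎ ∃₂ λ p q → x ∷ H ↭ p ++ q × Core p × NoEdges p q
  find-core x H d = grow d 8 refl refl [-]

  -- Degeneracy and the removal of small components

  data Stripped (H : List A) : List A → Set where
    []  : Stripped H []
    _∷_ : ∀ {x xs} → deg x (xs ++ H) ≤ 3 → Stripped H xs → Stripped H (x ∷ xs)

  strip : ∀ n L → length L ≤ n →
    ∃₂ λ xs H → L ↭ xs ++ H × Stripped H xs × All (λ x → 4 ≤ deg x H) H
  strip n L h with search (λ x → deg x L <ᵇ 4) L
  strip n L h | inj₂ none = [] , L , refl , [] ,
    All.map (λ {x} d → ≮⇒≥ (λ lt → false≢true (≡.trans (sym d) (<ᵇ-true lt)))) none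
    where
    false≢true : false ≡ true → ⊥
    false≢true ()
    <ᵇ-true : ∀ {m n} → m < n → (m <ᵇ n) ≡ true
    <ᵇ-true {m} {n} lt with m <ᵇ n | <⇒<ᵇ lt
    ... | true | _ = refl
  strip n       L h | inj₁ (x , L′ , σ , d) with n | ≤-trans (≤-reflexive (sym (↭-length σ))) h
  ... | suc m | s≤s h′ with strip m L′ h′
  ...   | xs , H , τ , s , ds = x ∷ xs , H , trans σ (prep x τ) , ≤-pred
    (subst (_< 4) (≡.trans (count-↭ (r x) σ) (≡.trans (deg-self x L′) (count-↭ (r x) τ)))
      (<ᵇ⇒< _ _ (subst T (sym d) tt))) ∷ s , ds

  edges-stripped : ∀ {H xs} → Stripped H xs → edges (xs ++ H) ≤ 3 * length xs + edges H
  edges-stripped [] = ≤-refl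
  edges-stripped {H} {x ∷ xs} (d ∷ s) = begin
    deg x (xs ++ H) + edges (xs ++ H)   ≤⟨ +-mono-≤ d (edges-stripped s) ⟩
    3 + (3 * length xs + edges H)       ≡⟨ arith (length xs) (edges H) ⟩
    3 * suc (length xs) + edges H       ∎
    where
    arith : ∀ n e → 3 + (3 * n + e) ≡ 3 * suc n + e
    arith = solve-∀

  stripped-sparse : ∀ {x xs} k → Stripped [] (x ∷ xs) → edges (xs ++ []) + k ≤ 3 * length xs →
    edges (x ∷ xs ++ []) + k ≤ 3 * suc (length xs)
  stripped-sparse {x} {xs} k (d ∷ s) h = begin
    deg x (xs ++ []) + edges (xs ++ []) + k    ≡⟨ +-assoc (deg x (xs ++ [])) _ k ⟩
    deg x (xs ++ []) + (edges (xs ++ []) + k)  ≤⟨ +-mono-≤ d h ⟩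
    3 + 3 * length xs                          ≡⟨ *-suc 3 (length xs) ⟨
    3 * suc (length xs)                        ∎

  stripped-one : ∀ {xs} → Stripped [] xs → 1 ≤ length xs → edges (xs ++ []) + 3 ≤ 3 * length xs
  stripped-one {_ ∷ []}     s       _ = ≤-refl
  stripped-one {_ ∷ _ ∷ xs} (d ∷ s) _ = stripped-sparse 3 (d ∷ s) (stripped-one s (s≤s z≤n))

  -- The last three vertices span at most 3 = 3 · 3 - 6 edges, and every vertex stripped before them
  -- contributes at most three.
  stripped-three : ∀ {xs} → Stripped [] xs → 3 ≤ length xs → edges (xs ++ []) + 6 ≤ 3 * length xs
  stripped-three {x ∷ y ∷ z ∷ []}     s       _ = +-monoˡ-≤ 6 (edges≤tri (x ∷ y ∷ z ∷ []))
  stripped-three {_ ∷ _ ∷ _ ∷ _ ∷ xs} (d ∷ s) _ =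
    stripped-sparse 6 (d ∷ s) (stripped-three s (s≤s (s≤s (s≤s z≤n))))
  stripped-three {_ ∷ []}     _ (s≤s ())
  stripped-three {_ ∷ _ ∷ []} _ (s≤s (s≤s ()))

  stripped-↭ : ∀ {H H′ xs} → H ↭ H′ → Stripped H xs → Stripped H′ xs
  stripped-↭ σ []                  = []
  stripped-↭ σ (_∷_ {x} {xs} d s) = subst (_≤ 3) (count-↭ (r x) (++⁺ˡ xs σ)) d ∷ stripped-↭ σ s

  BigCore : List A → Set
  BigCore L = ∃₂ λ p q → L ↭ p ++ q × Core p × 7 ≤ length p

  bigCore-⊆ : ∀ {xs ys zs} → zs ↭ xs ++ ys → BigCore xs → BigCore zs
  bigCore-⊆ {ys = ys} σ (p , q , τ , c , h) = p , q ++ ys , trans σ (trans (++⁺ʳ ys τ) (++-assoc p q ys)) , c , h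

  -- The final inequality says that the deficit 3n - e of the remainder `q` is at most k - 3.
  SmallCore : ℕ → List A → Set
  SmallCore k L = ∃₂ λ xs p → ∃ λ q → L ↭ xs ++ (p ++ q) × Stripped (p ++ q) xs × Core p × length p ≤ 6 ×
    3 * length q + 3 ≤ edges q + k

  length-↭-++ : ∀ {L : List A} xs {ys} → L ↭ xs ++ ys → length L ≡ length xs + length ys
  length-↭-++ xs σ = ≡.trans (↭-length σ) (length-++ xs)

  -- K₅ has 10 ≤ 12 edges and K₆ has exactly 15 = 3 · 6 - 3. This fails for K₇ with its 21 edges,
  -- hence the limit of six.
  core-edges : ∀ {p} → Core p → length p ≤ 6 → edges p + 3 ≤ 3 * length p
  core-edges {p} c h = ≤-trans (+-monoˡ-≤ 3 (edges≤tri p)) (bound (Core.atLeast c) h)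
    where
    bound : ∀ {n} → 5 ≤ n → n ≤ 6 → tri n + 3 ≤ 3 * n
    bound {n} h h′ with m≤n⇒m<n∨m≡n h′
    ... | inj₂ refl = ≤-refl
    ... | inj₁ h″ with ≤-antisym h (≤-pred h″)
    ...   | refl = m≤m+n 13 2

  remaining-budget : ∀ k {L} xs {H p q} → L ↭ xs ++ H → Stripped H xs → H ↭ p ++ q → NoEdges p q →
    Core p → length p ≤ 6 → 3 * length L ≤ edges L + k → 3 * length q + 3 ≤ edges q + k
  remaining-budget k {L} xs {H} {p} {q} σ s τ ne c p≤6 h =
    +-cancelˡ-≤ (3 * length xs + 3 * length p) _ _ (begin
      3 * length xs + 3 * length p + (3 * length q + 3)    ≡⟨ arith₁ (length xs) (length p) (length q) ⟩
      3 * (length xs + (length p + length q)) + 3          ≡⟨ cong (λ n → 3 * n + 3) lengths ⟨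
      3 * length L + 3                                     ≤⟨ +-monoˡ-≤ 3 h ⟩
      edges L + k + 3                                      ≡⟨ cong (λ e → e + k + 3) (edges-↭ σ) ⟩
      edges (xs ++ H) + k + 3                              ≤⟨ +-monoˡ-≤ 3 (+-monoˡ-≤ k (edges-stripped s)) ⟩
      3 * length xs + edges H + k + 3                      ≡⟨ cong (λ e → 3 * length xs + e + k + 3) (≡.trans (edges-↭ τ) (edges-++ ne)) ⟩
      3 * length xs + (edges p + edges q) + k + 3          ≡⟨ arith₂ (length xs) (edges p) (edges q) k ⟩
      3 * length xs + (edges p + 3) + (edges q + k)        ≤⟨ +-monoˡ-≤ _ (+-monoʳ-≤ (3 * length xs) (core-edges c p≤6)) ⟩
      3 * length xs + 3 * length p + (edges q + k)         ∎)
    where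
    lengths : length L ≡ length xs + (length p + length q)
    lengths = ≡.trans (length-↭-++ xs σ) (cong (length xs +_) (length-↭-++ p τ))
    arith₁ : ∀ a b c → 3 * a + 3 * b + (3 * c + 3) ≡ 3 * (a + (b + c)) + 3
    arith₁ = solve-∀
    arith₂ : ∀ a b c k → 3 * a + (b + c) + k + 3 ≡ 3 * a + (b + 3) + (c + k)
    arith₂ = solve-∀

  peel : ∀ k L → 3 * length L ≤ edges L + k →
    (∃ λ xs → L ↭ xs ++ [] × Stripped [] xs) ⊎ (HasPath L ⊎ BigCore L) ⊎ SmallCore k L
  peel k L h with strip (length L) L ≤-refl
  ... | xs , []    , σ , s , _ = inj₁ (xs , σ , s)
  ... | xs , x ∷ H , σ , s , d with find-core x H d
  ...   | inj₁ path = inj₂ (inj₁ (inj₁ (hasPath-⊆ (trans σ (++-comm xs (x ∷ H))) path)))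
  ...   | inj₂ (p , q , τ , c , ne) with 7 ≤? length p
  ...     | yes 7≤ = inj₂ (inj₁ (inj₂ (bigCore-⊆ (trans σ (++-comm xs (x ∷ H))) (p , q , τ , c , 7≤))))
  ...     | no 7≰  = inj₂ (inj₂ (xs , p , q , trans σ (++⁺ˡ xs τ) , stripped-↭ τ s , c , p≤6 ,
                remaining-budget k xs σ s τ ne c p≤6 h))
    where
    p≤6 : length p ≤ 6
    p≤6 = ≤-pred (≰⇒> 7≰)

  too-sparse : ∀ k {L xs} → L ↭ xs ++ [] → edges (xs ++ []) + suc k ≤ 3 * length xs →
    3 * length L ≤ edges L + k → ⊥
  too-sparse k {L} {xs} σ h h′ = <-irrefl refl (begin-strict
    edges L + k                 <⟨ +-monoʳ-< (edges L) (n<1+n k) ⟩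
    edges L + suc k             ≡⟨ cong (_+ suc k) (edges-↭ σ) ⟩
    edges (xs ++ []) + suc k    ≤⟨ h ⟩
    3 * length xs               ≡⟨ cong (3 *_) (≡.trans (↭-length σ) (↭-length (++-identityʳ xs))) ⟨
    3 * length L                ≤⟨ h′ ⟩
    edges L + k                 ∎)

  nonempty : ∀ {L : List A} {n} xs → L ↭ xs ++ [] → n ≤ length L → n ≤ length xs
  nonempty xs σ h = ≤-trans h (≤-reflexive (≡.trans (↭-length σ) (↭-length (++-identityʳ xs))))

  -- A nonempty graph of deficit at most 2 is not 3-degenerate. Removing a small core leaves
  -- negative deficit, so the remainder is again nonempty and the argument repeats on it until a
  -- core of order 7 or 8, or a P₉, appears.
  big-core : ∀ n L → length L ≤ n → 1 ≤ length L → 3 * length L ≤ edges L + 2 → HasPath L ⊎ BigCore L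
  big-core n L L≤n 1≤L h with peel 2 L h
  ... | inj₁ (xs , σ , s) = ⊥-elim (too-sparse 2 σ (stripped-one s (nonempty xs σ 1≤L)) h)
  ... | inj₂ (inj₁ outcome) = outcome
  ... | inj₂ (inj₂ (xs , p , []    , σ , s , c , p≤6 , b)) = case b of λ { (s≤s (s≤s ())) }
  ... | inj₂ (inj₂ (xs , p , y ∷ q , σ , s , c , p≤6 , b)) = recurse n L≤n
    where
    τ : L ↭ (y ∷ q) ++ (xs ++ p)
    τ = trans σ (trans (↭-sym (++-assoc xs p (y ∷ q))) (++-comm (xs ++ p) (y ∷ q)))
    lengths : length L ≡ length xs + (length p + length (y ∷ q))
    lengths = ≡.trans (length-↭-++ xs σ) (cong (length xs +_) (length-++ p))
    shorter : length (y ∷ q) < length L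
    shorter = begin-strict
      length (y ∷ q)                            <⟨ m<n+m (length (y ∷ q)) (≤-trans (s≤s z≤n) (Core.atLeast c)) ⟩
      length p + length (y ∷ q)                 ≤⟨ m≤n+m _ (length xs) ⟩
      length xs + (length p + length (y ∷ q))   ≡⟨ lengths ⟨
      length L                                  ∎
    recurse : ∀ n → length L ≤ n → HasPath L ⊎ BigCore L
    recurse zero    h  = ⊥-elim (n≮0 (≤-trans shorter h))
    recurse (suc n) h′ = Sum.map (hasPath-⊆ τ) (bigCore-⊆ τ)
      (big-core n (y ∷ q) (≤-pred (≤-trans shorter h′)) (s≤s z≤n) (≤-trans (m≤m+n _ 3) b))

  -- The last alternative does occur: K₃ joined to the disjoint union of an edge
  -- and n − 5 isolated vertices has exactly 3n − 5 edges.
  some-core : ∀ L → 3 ≤ length L → 3 * length L ≤ edges L + 5 →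
    (HasPath L ⊎ BigCore L) ⊎ ∃₂ λ xs p → L ↭ xs ++ p × Stripped p xs × Core p × length p ≤ 6
  some-core L 3≤L h with peel 5 L h
  ... | inj₁ (xs , σ , s) = ⊥-elim (too-sparse 5 σ (stripped-three s (nonempty xs σ 3≤L)) h)
  ... | inj₂ (inj₁ outcome) = inj₁ outcome
  ... | inj₂ (inj₂ (xs , p , []    , σ , s , c , p≤6 , b)) =
    inj₂ (xs , p , trans σ (++⁺ˡ xs (++-identityʳ p)) , stripped-↭ (++-identityʳ p) s , c , p≤6)
  -- The small core lowers the deficit from 5 to 2, the hypothesis of `big-core` for a nonempty
  -- remainder.
  ... | inj₂ (inj₂ (xs , p , y ∷ q , σ , s , c , p≤6 , b)) = inj₁ (Sum.map (hasPath-⊆ τ) (bigCore-⊆ τ)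
      (big-core _ (y ∷ q) ≤-refl (s≤s z≤n)
        (+-cancelʳ-≤ 3 _ _ (≤-trans b (≤-reflexive (sym (+-assoc (edges (y ∷ q)) 2 3)))))))
    where
    τ : L ↭ (y ∷ q) ++ (xs ++ p)
    τ = trans σ (trans (↭-sym (++-assoc xs p (y ∷ q))) (++-comm (xs ++ p) (y ∷ q)))

  -- Cores of order seven and eight

  MinDegree : ℕ → List A → Set
  MinDegree d p = All (λ x → d ≤ deg x p) p

  minDegree-↭ : ∀ {d p q} → p ↭ q → MinDegree d p → MinDegree d q
  minDegree-↭ {d} σ ds = ↭.All-resp-↭ σ (All.map (λ {x} → subst (d ≤_) (count-↭ (r x) σ)) ds)

  tail-path : ∀ {w x z} c → length (z ∷ c) ≡ 7 → MinDegree 4 (z ∷ c) →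
    r w x ≡ true → r x z ≡ true → HasPath (w ∷ x ∷ z ∷ c)
  tail-path {w} {x} {z} c@(_ ∷ _ ∷ _ ∷ _ ∷ _ ∷ _ ∷ []) _
    (d₁ ∷ d₂ ∷ d₃ ∷ d₄ ∷ d₅ ∷ d₆ ∷ d₇ ∷ []) wx xz =
    let _ , σ , l = rearranged (solution w (x ∷ z ∷ c) tail-solved refl
          (edge wx ∷ edge xz ∷ d₁ ∷ d₂ ∷ d₃ ∷ d₄ ∷ d₅ ∷ d₆ ∷ d₇ ∷ []))
    in spanning σ l refl

  pendant-path : ∀ {x y z z′} c → length (z ∷ z′ ∷ c) ≡ 7 → MinDegree 4 (z ∷ z′ ∷ c) →
    r x z ≡ true → r y z′ ≡ true → HasPath (x ∷ y ∷ z ∷ z′ ∷ c)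
  pendant-path {x} {y} {z} {z′} c@(_ ∷ _ ∷ _ ∷ _ ∷ _ ∷ []) _
    (d₁ ∷ d₂ ∷ d₃ ∷ d₄ ∷ d₅ ∷ d₆ ∷ d₇ ∷ []) xz yz′ =
    let _ , σ , l = rearranged (solution x (y ∷ z ∷ z′ ∷ c) pendants-solved refl
          (edge xz ∷ edge yz′ ∷ d₁ ∷ d₂ ∷ d₃ ∷ d₄ ∷ d₅ ∷ d₆ ∷ d₇ ∷ []))
    in spanning σ l refl

  lastOf-All : ∀ {Q : A → Set} {x} p → All Q (x ∷ p) → Q (lastOf x p)
  lastOf-All []      (q ∷ _)  = q
  lastOf-All (_ ∷ p) (_ ∷ qs) = lastOf-All p qs

  absorb-core : ∀ {p y} → Core p → any (r y) p ≡ true → ∃ λ q → q ↭ y ∷ p × Path q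
  absorb-core {x ∷ p} (core l d ≥5 ≤8) h = absorb ≥5 ≤8 l (All.head d) (lastOf-All p d) h

  edges-prefix : ∀ X {M} → All (λ x → deg x (X ++ M) ≤ 1) X → edges (X ++ M) ≤ length X + edges M
  edges-prefix []      []       = ≤-refl
  edges-prefix (x ∷ X) {M} (d ∷ ds) = begin
    deg x (X ++ M) + edges (X ++ M)  ≤⟨ +-mono-≤ (≤-trans (m≤n+m _ (bit (r x x))) d)
      (edges-prefix X (All.map (λ {y} → ≤-trans (m≤n+m _ (bit (r y x)))) ds)) ⟩
    1 + (length X + edges M)         ∎

  -- 21 counts the edges of K₇, and k the pendant edges attached to it.
  Cut : List A → Set
  Cut L = ∃ λ k → ∃₂ λ p q → L ↭ p ++ q × NoEdges p q × length p ≡ 7 + k ×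
    (k ≤ 1 ⊎ edges L ≤ k + (21 + tri (length q)))

  cut-eight : ∀ {L} p q → L ↭ p ++ q → Core p → length p ≡ 8 → HasPath L ⊎ Cut L
  cut-eight p q σ c h with search (λ y → any (r y) p) q
  ... | inj₁ (y , q′ , τ , e) =
    let _ , ρ , l = absorb-core c e
    in inj₁ (hasPath-⊆ (trans σ (trans (++⁺ˡ p τ) (shift y p q′))) (spanning ρ l (cong suc h)))
  ... | inj₂ none = inj₂ (1 , p , q , σ , noEdges-swap none , h , inj₁ ≤-refl)

  module Attached {L p X Y} (σ : L ↭ p ++ (X ++ Y)) (c : Core p) (h : length p ≡ 7)
    (attached : All (λ y → any (r y) p ≡ true) X) where

    attachment : ∀ {x} → any (r x) p ≡ true → ∃₂ λ z p′ → p ↭ z ∷ p′ × r x z ≡ true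
    attachment {x} a with search (r x) p
    ... | inj₁ hit = hit
    ... | inj₂ none = contradictory a (All-any none)
      where
      contradictory : ∀ {b} {B : Set} → b ≡ true → b ≡ false → B
      contradictory refl ()
      All-any : ∀ {xs} → All (λ z → r x z ≡ false) xs → any (r x) xs ≡ false
      All-any []       = refl
      All-any (q ∷ qs) rewrite q = All-any qs

    length-as : ∀ {z p′} → p ↭ z ∷ p′ → length (z ∷ p′) ≡ 7
    length-as τ = ≡.trans (sym (↭-length τ)) h

    -- A neighbour w of an attached vertex x outside the core would give a tail w, x, which a
    -- seven-vertex core completes to a P₉.
    isolated : HasPath L ⊎ All (λ x → deg x (X ++ Y) ≡ 0) X
    isolated = each X λ {x} {X′} τ → case search (r x) (X′ ++ Y) of λ where
      (inj₁ (w , R , ρ , e)) →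
        let z , p′ , π , xz = attachment (All.head (↭.All-resp-↭ τ attached))
        in inj₁ (hasPath-⊆
             (trans σ (trans (++⁺ π (trans (++⁺ʳ Y τ) (prep x ρ))) (trans (++-comm (z ∷ p′) (x ∷ w ∷ R))
               (swap x w (++-comm R (z ∷ p′))))))
             (tail-path p′ (length-as π) (minDegree-↭ π (Core.minDeg c)) (adjacent-sym e) xz))
      (inj₂ none) → inj₂ (≡.trans (count-↭ (r x) (++⁺ʳ Y τ)) (≡.trans (deg-self x (X′ ++ Y)) (count-none none)))

    -- Two vertices attached at different core vertices would be the ends of a P₉ through the whole
    -- core.
    pendants-at : ∀ {x y X′ z p′} → X ↭ x ∷ y ∷ X′ → p ↭ z ∷ p′ → r x z ≡ true →
      HasPath L ⊎ All (λ z′ → r y z′ ≡ false) p′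
    pendants-at {x} {y} {X′} {z} {p′} τ π xz with search (r y) p′
    ... | inj₂ none = inj₂ none
    ... | inj₁ (z′ , p″ , ρ , e) = inj₁ (hasPath-⊆
      (trans σ (trans (++-comm p (X ++ Y)) (trans (++⁺ (++⁺ʳ Y τ) π′)
        (prep x (prep y (++-comm (X′ ++ Y) (z ∷ z′ ∷ p″)))))))
      (pendant-path p″ (length-as π′) (minDegree-↭ π′ (Core.minDeg c)) xz e))
      where
      π′ : p ↭ z ∷ z′ ∷ p″
      π′ = trans π (prep z ρ)

  -- Two or more attached vertices all hang on the same core vertex and have no other neighbour, so
  -- each contributes one edge. A single attached vertex may have many neighbours in the core, but
  -- then k = 1.
  cut-seven : ∀ {L} p q → L ↭ p ++ q → Core p → length p ≡ 7 → HasPath L ⊎ Cut L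
  cut-seven {L} p q σ c h with separate (λ y → any (r y) p) q
  ... | X , Y , τ , attached , unattached = conclude isolated
    where
    σ′ : L ↭ p ++ (X ++ Y)
    σ′ = trans σ (++⁺ˡ p τ)
    open Attached {Y = Y} σ′ c h attached

    single : ∀ {x z p′} → p ↭ z ∷ p′ → All (λ z′ → r x z′ ≡ false) p′ → deg x p ≤ 1
    single {x} {z} π none = ≤-trans (≤-reflexive (count-↭ (r x) π))
      (+-mono-≤ (bit≤1 (r x z)) (≤-reflexive (count-none none)))

    attach-once : 2 ≤ length X → HasPath L ⊎ All (λ x → deg x p ≤ 1) X
    attach-once ≥2 = go X refl ≥2
      where
      go : ∀ X′ → X ↭ X′ → 2 ≤ length X′ → HasPath L ⊎ All (λ x → deg x p ≤ 1) X
      go (_ ∷ []) _ (s≤s ())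
      go (x ∷ y ∷ X′) ρ _ with ↭.All-resp-↭ ρ attached
      ... | ax ∷ ay ∷ _ with attachment ax
      ...   | z , p′ , π , xz with each (y ∷ X′) (λ {y′} {X″} τ′ → pendants-at {x} {y′} {X″} (trans ρ (prep x τ′)) π xz)
      ...     | inj₁ path = inj₁ path
      -- All attached vertices other than x can meet the core only in z. Since y is attached, it
      -- does meet z, and exchanging the roles of x and y confines x to z as well.
      ...     | inj₂ nones with pendants-at (trans ρ (swap x y refl)) π yz
        where
        yz : r y z ≡ true
        yz with r y z in eq
        ... | true  = refl
        ... | false = let z′ , p″ , π′ , e = attachment ay in
          case All.head (↭.All-resp-↭ (trans (↭-sym π) π′) (eq ∷ All.head nones)) of λ e′ →
            case ≡.trans (sym e) e′ of λ ()
      ...       | inj₁ path = inj₁ path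
      ...       | inj₂ none = inj₂ (↭.All-resp-↭ (↭-sym ρ) (single π none ∷ All.map (single π) nones))

    conclude : HasPath L ⊎ All (λ x → deg x (X ++ Y) ≡ 0) X → HasPath L ⊎ Cut L
    conclude (inj₁ path) = inj₁ path
    conclude (inj₂ iso) = bounded (length X ≤? 1)
      where
      noEdges : NoEdges (p ++ X) Y
      noEdges = All.++⁺ (noEdges-swap {p} unattached)
        (All.map (λ {x} d → ++⁻ʳ X (count-zero (X ++ Y) d)) iso)
      result : length X ≤ 1 ⊎ edges L ≤ length X + (21 + tri (length Y)) → Cut L
      result b = length X , p ++ X , Y , trans σ′ (↭-sym (++-assoc p X Y)) , noEdges ,
        ≡.trans (length-++ p) (cong (_+ length X) h) , b
      bounded : Dec (length X ≤ 1) → HasPath L ⊎ Cut L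
      bounded (yes ≤1) = inj₂ (result (inj₁ ≤1))
      bounded (no ≰1)  = Sum.map₂ (λ once → result (inj₂ (begin
        edges L                                 ≡⟨ edges-↭ (trans σ′ (shifts p X)) ⟩
        edges (X ++ (p ++ Y))                   ≤⟨ edges-prefix X (low iso once) ⟩
        length X + edges (p ++ Y)               ≡⟨ cong (length X +_) (edges-++ (noEdges-swap {p} unattached)) ⟩
        length X + (edges p + edges Y)          ≤⟨ +-monoʳ-≤ (length X) (+-mono-≤ (≤-trans (edges≤tri p) (≤-reflexive (cong tri h))) (edges≤tri Y)) ⟩
        length X + (21 + tri (length Y))        ∎)))
        (attach-once (≰⇒> ≰1))
        where
        low : ∀ {X′} → All (λ x → deg x (X ++ Y) ≡ 0) X′ → All (λ x → deg x p ≤ 1) X′ →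
          All (λ x → deg x (X ++ (p ++ Y)) ≤ 1) X′
        low []       []       = []
        low (_∷_ {x} d ds) (e ∷ es) = ≤-trans (≤-reflexive (≡.trans (count-↭ (r x) (shifts X p))
          (≡.trans (count-++ (r x) p (X ++ Y)) (≡.trans (cong (deg x p +_) d) (+-identityʳ _))))) e ∷ low ds es

  cut : ∀ {L} → BigCore L → HasPath L ⊎ Cut L
  cut (p , q , σ , c , 7≤) with m≤n⇒m<n∨m≡n (Core.atMost c)
  ... | inj₂ ≡8 = cut-eight p q σ c ≡8
  ... | inj₁ <8 = cut-seven p q σ c (≤-antisym (≤-pred <8) 7≤)

  -- Cores of order six

  split-end : ∀ n (xs : List A) → n ≤ length xs → ∃₂ λ ys zs → xs ≡ ys ++ zs × length zs ≡ n
  split-end n []       z≤n = [] , [] , refl , refl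
  split-end n (x ∷ xs) h with m≤n⇒m<n∨m≡n h
  ... | inj₂ refl = [] , x ∷ xs , refl , refl
  ... | inj₁ lt with split-end n xs (≤-pred lt)
  ...   | ys , zs , refl , l = x ∷ ys , zs , refl , l

  stripped-suffix : ∀ {H} ys {zs} → Stripped H (ys ++ zs) → Stripped H zs
  stripped-suffix []       s       = s
  stripped-suffix (_ ∷ ys) (_ ∷ s) = stripped-suffix ys s

  edges-suffix : ∀ {H} ys {zs} → Stripped H (ys ++ zs) →
    edges ((ys ++ zs) ++ H) ≤ 3 * length ys + edges (zs ++ H)
  edges-suffix []       s = ≤-refl
  edges-suffix {H} (y ∷ ys) {zs} (d ∷ s) = begin
    deg y ((ys ++ zs) ++ H) + edges ((ys ++ zs) ++ H)  ≤⟨ +-mono-≤ d (edges-suffix ys s) ⟩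
    3 + (3 * length ys + edges (zs ++ H))              ≡⟨ +-assoc 3 (3 * length ys) _ ⟨
    3 + 3 * length ys + edges (zs ++ H)                ≡⟨ cong (_+ edges (zs ++ H)) (*-suc 3 (length ys)) ⟨
    3 * suc (length ys) + edges (zs ++ H)              ∎

  hasPath-↭ : ∀ {xs ys} → xs ↭ ys → HasPath xs → HasPath ys
  hasPath-↭ σ (p , q , τ , l , h) = p , q , trans τ σ , l , h

  path-from : ∀ {z p} → length (z ∷ p) ≡ 6 → MinDegree 4 (z ∷ p) → ∃ λ q → z ∷ q ↭ z ∷ p × Path (z ∷ q)
  path-from {z} {p@(_ ∷ _ ∷ _ ∷ _ ∷ _ ∷ [])} _ (d₁ ∷ d₂ ∷ d₃ ∷ d₄ ∷ d₅ ∷ d₆ ∷ []) =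
    from-start (solution z p sixFrom-solved refl (d₁ ∷ d₂ ∷ d₃ ∷ d₄ ∷ d₅ ∷ d₆ ∷ []))
    where
    from-start : Solution sixFrom z p → ∃ λ q → z ∷ q ↭ z ∷ p × Path (z ∷ q)
    from-start (found {start = zero} _ σ l) = _ , σ , l

  -- The minimal triples of degrees at most three with sum seven.
  Thresholds : ℕ → ℕ → ℕ → Set
  Thresholds a b c = 1 ≤ a × (3 ≤ a × 3 ≤ b × 1 ≤ c ⊎ 3 ≤ a × 1 ≤ b × 3 ≤ c ⊎ 1 ≤ a × 3 ≤ b × 3 ≤ c ⊎
    3 ≤ a × 2 ≤ b × 2 ≤ c ⊎ 2 ≤ a × 3 ≤ b × 2 ≤ c ⊎ 2 ≤ a × 2 ≤ b × 3 ≤ c)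

  thresholds : ∀ {a b c} → a ≤ 3 → b ≤ 3 → c ≤ 3 → 7 ≤ c + (b + a) → Thresholds a b c
  thresholds {a} {b} {c} a≤ b≤ c≤ =
    subst (λ n → 7 ≤ c + (b + n) → Thresholds n b c) (Fin.toℕ-fromℕ< (s≤s a≤))
    (subst (λ n → 7 ≤ c + (n + toℕ i) → Thresholds (toℕ i) n c) (Fin.toℕ-fromℕ< (s≤s b≤))
    (subst (λ n → 7 ≤ n + (toℕ j + toℕ i) → Thresholds (toℕ i) (toℕ j) n) (Fin.toℕ-fromℕ< (s≤s c≤))
      (toWitness {a? = Fin.all? λ i → Fin.all? λ j → Fin.all? λ k → check (toℕ i) (toℕ j) (toℕ k)} tt i j k)))
    where
    i j k : Fin 4
    i = fromℕ< (s≤s a≤)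
    j = fromℕ< (s≤s b≤)
    k = fromℕ< (s≤s c≤)
    check : ∀ a b c → Dec (7 ≤ c + (b + a) → Thresholds a b c)
    check a b c = 7 ≤? c + (b + a) →-dec (1 ≤? a ×-dec (at-least 3 3 1 ⊎-dec at-least 3 1 3 ⊎-dec
      at-least 1 3 3 ⊎-dec at-least 3 2 2 ⊎-dec at-least 2 3 2 ⊎-dec at-least 2 2 3))
      where
      at-least : ∀ k l m → Dec (k ≤ a × l ≤ b × m ≤ c)
      at-least k l m = k ≤? a ×-dec (l ≤? b ×-dec m ≤? c)

  six-plus-three : ∀ {x₁ x₂ x₃ z p} → length (z ∷ p) ≡ 6 → Path (z ∷ p) → MinDegree 4 (z ∷ p) → r x₁ z ≡ true →
    Thresholds (deg x₁ (z ∷ p)) (deg x₂ (x₁ ∷ z ∷ p)) (deg x₃ (x₂ ∷ x₁ ∷ z ∷ p)) →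
    HasPath (x₃ ∷ x₂ ∷ x₁ ∷ z ∷ p)
  six-plus-three {x₁} {x₂} {x₃} {z} {p@(_ ∷ _ ∷ _ ∷ _ ∷ _ ∷ [])} _
    (e₁ ∷ e₂ ∷ e₃ ∷ e₄ ∷ e₅ ∷ [-]) (d₁ ∷ d₂ ∷ d₃ ∷ d₄ ∷ d₅ ∷ d₆ ∷ []) xz (_ , t) = cases t
    where
    p₁ = proj₁ sixPlus-solved
    p₂ = proj₂ sixPlus-solved
    p₃ = proj₂ p₂
    p₄ = proj₂ p₃
    p₅ = proj₂ p₄
    done : ∀ {P v vs} → v ∷ vs ↭ x₃ ∷ x₂ ∷ x₁ ∷ z ∷ p → Solution P v vs → HasPath (x₃ ∷ x₂ ∷ x₁ ∷ z ∷ p)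
    done σ (found _ τ l) = spanning (trans τ σ) l refl
    cases : _ → _
    cases (inj₁ (a , b , c)) = done refl (solution x₃ (x₂ ∷ x₁ ∷ z ∷ p) p₁ refl
      (edge xz ∷ a ∷ b ∷ c ∷ edge e₁ ∷ edge e₂ ∷ edge e₃ ∷ edge e₄ ∷ edge e₅ ∷ d₁ ∷ d₂ ∷ d₃ ∷ d₄ ∷ d₅ ∷ d₆ ∷ []))
    cases (inj₂ (inj₁ (a , b , c))) = done (swap x₂ x₃ refl) (solution x₂ (x₃ ∷ x₁ ∷ z ∷ p) (proj₁ p₂) refl
      (edge xz ∷ a ∷ b ∷ c ∷ edge e₁ ∷ edge e₂ ∷ edge e₃ ∷ edge e₄ ∷ edge e₅ ∷ d₁ ∷ d₂ ∷ d₃ ∷ d₄ ∷ d₅ ∷ d₆ ∷ []))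
    cases (inj₂ (inj₂ (inj₁ (a , b , c)))) = done (trans (swap x₁ x₃ refl) (prep x₃ (swap x₁ x₂ refl)))
      (solution x₁ (x₃ ∷ x₂ ∷ z ∷ p) (proj₁ p₃) refl
      (edge xz ∷ a ∷ b ∷ c ∷ edge e₁ ∷ edge e₂ ∷ edge e₃ ∷ edge e₄ ∷ edge e₅ ∷ d₁ ∷ d₂ ∷ d₃ ∷ d₄ ∷ d₅ ∷ d₆ ∷ []))
    cases (inj₂ (inj₂ (inj₂ (inj₁ (a , b , c))))) = done refl (solution x₃ (x₂ ∷ x₁ ∷ z ∷ p) (proj₁ p₄) refl
      (edge xz ∷ a ∷ b ∷ c ∷ edge e₁ ∷ edge e₂ ∷ edge e₃ ∷ edge e₄ ∷ edge e₅ ∷ d₁ ∷ d₂ ∷ d₃ ∷ d₄ ∷ d₅ ∷ d₆ ∷ []))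
    cases (inj₂ (inj₂ (inj₂ (inj₂ (inj₁ (a , b , c)))))) = done (prep x₃ (swap x₁ x₂ refl))
      (solution x₃ (x₁ ∷ x₂ ∷ z ∷ p) (proj₁ p₅) refl
      (edge xz ∷ a ∷ b ∷ c ∷ edge e₁ ∷ edge e₂ ∷ edge e₃ ∷ edge e₄ ∷ edge e₅ ∷ d₁ ∷ d₂ ∷ d₃ ∷ d₄ ∷ d₅ ∷ d₆ ∷ []))
    cases (inj₂ (inj₂ (inj₂ (inj₂ (inj₂ (a , b , c)))))) = done
      (trans (prep x₂ (swap x₁ x₃ refl)) (swap x₂ x₃ refl))
      (solution x₂ (x₁ ∷ x₃ ∷ z ∷ p) (proj₂ p₅) refl
      (edge xz ∷ a ∷ b ∷ c ∷ edge e₁ ∷ edge e₂ ∷ edge e₃ ∷ edge e₄ ∷ edge e₅ ∷ d₁ ∷ d₂ ∷ d₃ ∷ d₄ ∷ d₅ ∷ d₆ ∷ []))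

  -- The core has at most 15 edges and the eight vertices stripped first account for at most 24, so
  -- the last three have at least 46 - 39 = 7 neighbours in total at the time of their removal.
  six-case : ∀ {L xs p} → L ↭ xs ++ p → Stripped p xs → Core p → length p ≡ 6 → length xs ≡ 11 →
    46 ≤ edges L → HasPath L
  six-case {L} {xs} {p} σ s c h h′ 46≤ with split-end 3 xs (≤-trans (m≤m+n 3 8) (≤-reflexive (sym h′)))
  ... | ys , x₃ ∷ x₂ ∷ x₁ ∷ [] , refl , refl with stripped-suffix ys s
  ...   | b₃ ∷ b₂ ∷ b₁ ∷ [] = conclude (thresholds b₁ b₂ b₃ seven)
    where
    eight : length ys ≡ 8
    eight = +-cancelʳ-≡ 3 _ _ (≡.trans (sym (length-++ ys)) h′)
    seven : 7 ≤ deg x₃ (x₂ ∷ x₁ ∷ p) + (deg x₂ (x₁ ∷ p) + deg x₁ p)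
    seven = +-cancelˡ-≤ 39 _ _ (begin
      46                                            ≤⟨ 46≤ ⟩
      edges L                                       ≡⟨ edges-↭ σ ⟩
      edges ((ys ++ x₃ ∷ x₂ ∷ x₁ ∷ []) ++ p)        ≤⟨ edges-suffix ys s ⟩
      3 * length ys + edges (x₃ ∷ x₂ ∷ x₁ ∷ p)      ≡⟨ cong (λ n → 3 * n + edges (x₃ ∷ x₂ ∷ x₁ ∷ p)) eight ⟩
      24 + (d₃ + (d₂ + (d₁ + edges p)))             ≤⟨ +-monoʳ-≤ 24 (+-monoʳ-≤ d₃ (+-monoʳ-≤ d₂ (+-monoʳ-≤ d₁
                                                        (≤-trans (edges≤tri p) (≤-reflexive (cong tri h)))))) ⟩
      24 + (d₃ + (d₂ + (d₁ + 15)))                  ≡⟨ arith d₁ d₂ d₃ ⟩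
      39 + (d₃ + (d₂ + d₁))                         ∎)
      where
      d₁ = deg x₁ p
      d₂ = deg x₂ (x₁ ∷ p)
      d₃ = deg x₃ (x₂ ∷ x₁ ∷ p)
      arith : ∀ a b c → 24 + (c + (b + (a + 15))) ≡ 39 + (c + (b + a))
      arith = solve-∀
    conclude : Thresholds (deg x₁ p) (deg x₂ (x₁ ∷ p)) (deg x₃ (x₂ ∷ x₁ ∷ p)) → HasPath L
    conclude t with pick p (proj₁ t)
    ... | z , p′ , τ , xz , _ with path-from (≡.trans (sym (↭-length τ)) h) (minDegree-↭ τ (Core.minDeg c))
    ...   | q , ρ , l = hasPath-⊆ (trans σ (trans (++-assoc ys (x₃ ∷ x₂ ∷ x₁ ∷ []) p)
              (++-comm ys (x₃ ∷ x₂ ∷ x₁ ∷ p))))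
            (hasPath-↭ (prep x₃ (prep x₂ (prep x₁ (↭-sym π))))
              (six-plus-three (≡.trans (sym (↭-length π)) h) l (minDegree-↭ π (Core.minDeg c)) xz
                (transported (count-↭ (r x₁) π) (count-↭ (r x₂) (prep x₁ π)) (count-↭ (r x₃) (prep x₂ (prep x₁ π))) t)))
      where
      π : p ↭ z ∷ q
      π = trans τ (↭-sym ρ)
      transported : ∀ {a a′ b b′ c c′} → a ≡ a′ → b ≡ b′ → c ≡ c′ → Thresholds a b c → Thresholds a′ b′ c′
      transported refl refl refl t = t

  -- Cores of order five

  data Thick (H : List A) : List A → Set where
    []  : Thick H []
    _∷_ : ∀ {x xs} → 3 ≤ deg x (xs ++ H) → Thick H xs → Thick H (x ∷ xs)

  -- Each stripped vertex contributes at most three edges and `H` at most `k`, so a total of at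
  -- least the sum of these bounds forces equality in each.
  thick : ∀ {H xs k} → Stripped H xs → edges H ≤ k → 3 * length xs + k ≤ edges (xs ++ H) →
    Thick H xs × k ≤ edges H
  thick []                  h b = [] , b
  thick {H} {x ∷ xs} {k} (d ∷ s) h b =
    let t , h′ = thick s h (+-cancelˡ-≤ 3 _ _ (≤-trans budget (+-monoˡ-≤ _ d)))
    in +-cancelʳ-≤ (3 * length xs + k) _ _
         (≤-trans budget (+-monoʳ-≤ (deg x (xs ++ H)) (≤-trans (edges-stripped s) (+-monoʳ-≤ _ h)))) ∷ t , h′
    where
    budget : 3 + (3 * length xs + k) ≤ deg x (xs ++ H) + edges (xs ++ H)
    budget = ≤-trans (≤-reflexive (≡.trans (sym (+-assoc 3 (3 * length xs) k)) (cong (_+ k) (sym (*-suc 3 (length xs)))))) b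

  thick-suffix : ∀ {H} ys {zs} → Thick H (ys ++ zs) → Thick H zs
  thick-suffix []       t       = t
  thick-suffix (_ ∷ ys) (_ ∷ t) = thick-suffix ys t

  thick-↭ : ∀ {H H′ xs} → H ↭ H′ → Thick H xs → Thick H′ xs
  thick-↭ σ []                 = []
  thick-↭ σ (_∷_ {x} {xs} d t) = subst (3 ≤_) (count-↭ (r x) (++⁺ˡ xs σ)) d ∷ thick-↭ σ t

  count-full : ∀ {P : A → Bool} xs → length xs ≤ count P xs → All (λ x → P x ≡ true) xs
  count-full []       h = []
  count-full {P} (x ∷ xs) h with P x in eq
  ... | true  = eq ∷ count-full xs (≤-pred h)
  ... | false = ⊥-elim (<⇒≱ (s≤s (count≤length P xs)) h)

  Clique : List A → Set
  Clique = AllPairs (Adjacent r)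

  full-clique : ∀ xs → tri (length xs) ≤ edges xs → Clique xs
  full-clique []       h = []
  full-clique (x ∷ xs) h =
    count-full xs (+-cancelʳ-≤ (tri (length xs)) _ _ (≤-trans h (+-monoʳ-≤ (deg x xs) (edges≤tri xs)))) ∷
    full-clique xs (+-cancelˡ-≤ (length xs) _ _ (≤-trans h (+-monoˡ-≤ (edges xs) (count≤length (r x) xs))))

  reindex : ∀ (v : A) (vs : List A) is → isPermutation is (upTo (suc (length vs))) ≡ true →
    map (λ i → nth v i (v ∷ vs)) is ↭ v ∷ vs
  reindex v vs is h = trans (↭.map⁺ _ (isPermutation-↭ is _ h)) (↭-reflexive (nth-upTo (v ∷ vs)))

  deg-drop : ∀ {d x c L M} → L ↭ c ∷ M → r x c ≡ false → d ≤ deg x L → d ≤ deg x M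
  deg-drop {d} {x} {c} {L} {M} σ h b =
    subst (d ≤_) (≡.trans (count-↭ (r x) σ) (cong (λ e → bit e + deg x M) h)) b

  module FiveClique {c₁ c₂ c₃ c₄ c₅ : A} (K : Clique (c₁ ∷ c₂ ∷ c₃ ∷ c₄ ∷ c₅ ∷ [])) where

    C : List A
    C = c₁ ∷ c₂ ∷ c₃ ∷ c₄ ∷ c₅ ∷ []

    Triple : A → Set
    Triple x = r x c₁ ≡ true × r x c₂ ≡ true × r x c₃ ≡ true

    clique-holds : ∀ {x₁ x₂ x₃ x₄} → let at = λ i → nth x₄ i (x₄ ∷ x₃ ∷ x₂ ∷ x₁ ∷ C) in
      All (Holds λ i j → r (at i) (at j)) (clique (range 4 5))
    clique-holds = go K
      where
      go : Clique C → _
      go ((k₁ ∷ k₂ ∷ k₃ ∷ k₄ ∷ []) ∷ (k₅ ∷ k₆ ∷ k₇ ∷ []) ∷ (k₈ ∷ k₉ ∷ []) ∷ (k₁₀ ∷ []) ∷ [] ∷ []) =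
        edge k₁ ∷ edge k₂ ∷ edge k₃ ∷ edge k₄ ∷ edge k₅ ∷ edge k₆ ∷ edge k₇ ∷ edge k₈ ∷ edge k₉ ∷ edge k₁₀ ∷ []

    second-triple : ∀ {x₁ x₂ x₃ x₄} → Triple x₁ → 3 ≤ deg x₂ (x₁ ∷ C) → 3 ≤ deg x₃ (x₂ ∷ x₁ ∷ C) →
      3 ≤ deg x₄ (x₃ ∷ x₂ ∷ x₁ ∷ C) → HasPath (x₄ ∷ x₃ ∷ x₂ ∷ x₁ ∷ C) ⊎ Triple x₂
    second-triple {x₁} {x₂} {x₃} {x₄} (t₁ , t₂ , t₃) d₂ d₃ d₄ =
      decide (r x₂ c₁) (r x₂ c₂) (r x₂ c₃) refl refl refl
      where
      done : ∀ {P} → Solution P x₄ (x₃ ∷ x₂ ∷ x₁ ∷ C) → HasPath (x₄ ∷ x₃ ∷ x₂ ∷ x₁ ∷ C) ⊎ Triple x₂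
      done (found _ σ l) = inj₁ (spanning σ l refl)
      decide : ∀ b₁ b₂ b₃ → r x₂ c₁ ≡ b₁ → r x₂ c₂ ≡ b₂ → r x₂ c₃ ≡ b₃ →
        HasPath (x₄ ∷ x₃ ∷ x₂ ∷ x₁ ∷ C) ⊎ Triple x₂
      decide true true true h₁ h₂ h₃ = inj₂ (h₁ , h₂ , h₃)
      decide false _ _ h _ _ =
        done (solution x₄ (x₃ ∷ x₂ ∷ x₁ ∷ C) (proj₁ secondAdded-solved) refl
          (d₄ ∷ d₃ ∷ deg-drop {M = x₁ ∷ c₂ ∷ c₃ ∷ c₄ ∷ c₅ ∷ []} (swap x₁ c₁ refl) h d₂ ∷ edge t₁ ∷ edge t₂ ∷ edge t₃ ∷ clique-holds))
      decide true false _ _ h _ =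
        done (solution x₄ (x₃ ∷ x₂ ∷ x₁ ∷ C) (proj₁ (proj₂ secondAdded-solved)) refl
          (d₄ ∷ d₃ ∷ deg-drop (shift c₂ (x₁ ∷ c₁ ∷ []) (c₃ ∷ c₄ ∷ c₅ ∷ [])) h d₂ ∷ edge t₁ ∷ edge t₂ ∷ edge t₃ ∷ clique-holds))
      decide true true false _ _ h =
        done (solution x₄ (x₃ ∷ x₂ ∷ x₁ ∷ C) (proj₂ (proj₂ secondAdded-solved)) refl
          (d₄ ∷ d₃ ∷ deg-drop (shift c₃ (x₁ ∷ c₁ ∷ c₂ ∷ []) (c₄ ∷ c₅ ∷ [])) h d₂ ∷ edge t₁ ∷ edge t₂ ∷ edge t₃ ∷ clique-holds))

    third-triple : ∀ {x₁ x₂ x₃ x₄} → Triple x₁ → Triple x₂ → 3 ≤ deg x₃ (x₂ ∷ x₁ ∷ C) →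
      3 ≤ deg x₄ (x₃ ∷ x₂ ∷ x₁ ∷ C) → HasPath (x₄ ∷ x₃ ∷ x₂ ∷ x₁ ∷ C) ⊎ Triple x₃
    third-triple {x₁} {x₂} {x₃} {x₄} (t₁ , t₂ , t₃) (u₁ , u₂ , u₃) d₃ d₄ =
      decide (r x₃ c₁) (r x₃ c₂) (r x₃ c₃) refl refl refl
      where
      done : ∀ {P} → Solution P x₄ (x₃ ∷ x₂ ∷ x₁ ∷ C) → HasPath (x₄ ∷ x₃ ∷ x₂ ∷ x₁ ∷ C) ⊎ Triple x₃
      done (found _ σ l) = inj₁ (spanning σ l refl)
      decide : ∀ b₁ b₂ b₃ → r x₃ c₁ ≡ b₁ → r x₃ c₂ ≡ b₂ → r x₃ c₃ ≡ b₃ →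
        HasPath (x₄ ∷ x₃ ∷ x₂ ∷ x₁ ∷ C) ⊎ Triple x₃
      decide true true true h₁ h₂ h₃ = inj₂ (h₁ , h₂ , h₃)
      decide false _ _ h _ _ =
        done (solution x₄ (x₃ ∷ x₂ ∷ x₁ ∷ C) (proj₁ thirdAdded-solved) refl
          (d₄ ∷ deg-drop (shift c₁ (x₂ ∷ x₁ ∷ []) (c₂ ∷ c₃ ∷ c₄ ∷ c₅ ∷ [])) h d₃ ∷ edge u₁ ∷ edge u₂ ∷ edge u₃ ∷
           edge t₁ ∷ edge t₂ ∷ edge t₃ ∷ clique-holds))
      decide true false _ _ h _ =
        done (solution x₄ (x₃ ∷ x₂ ∷ x₁ ∷ C) (proj₁ (proj₂ thirdAdded-solved)) refl
          (d₄ ∷ deg-drop (shift c₂ (x₂ ∷ x₁ ∷ c₁ ∷ []) (c₃ ∷ c₄ ∷ c₅ ∷ [])) h d₃ ∷ edge u₁ ∷ edge u₂ ∷ edge u₃ ∷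
           edge t₁ ∷ edge t₂ ∷ edge t₃ ∷ clique-holds))
      decide true true false _ _ h =
        done (solution x₄ (x₃ ∷ x₂ ∷ x₁ ∷ C) (proj₂ (proj₂ thirdAdded-solved)) refl
          (d₄ ∷ deg-drop (shift c₃ (x₂ ∷ x₁ ∷ c₁ ∷ c₂ ∷ []) (c₄ ∷ c₅ ∷ [])) h d₃ ∷ edge u₁ ∷ edge u₂ ∷ edge u₃ ∷
           edge t₁ ∷ edge t₂ ∷ edge t₃ ∷ clique-holds))

    -- The path is w, x, c₁, y, c₂, z, c₃, c₄, c₅; it excludes edges between added vertices.
    path-via-triple : ∀ {w x y z} → Triple x → Triple y → Triple z → r w x ≡ true → HasPath (w ∷ x ∷ y ∷ z ∷ C)
    path-via-triple {w} {x} {y} {z} (x₁ , _) (y₁ , y₂ , _) (_ , z₂ , z₃) h = go K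
      where
      go : Clique C → HasPath (w ∷ x ∷ y ∷ z ∷ C)
      go (_ ∷ _ ∷ (k₃₄ ∷ _) ∷ (k₄₅ ∷ _) ∷ _) =
        spanning (reindex w (x ∷ y ∷ z ∷ C) (0 ∷ 1 ∷ 4 ∷ 2 ∷ 5 ∷ 3 ∷ 6 ∷ 7 ∷ 8 ∷ []) refl)
          (h ∷ x₁ ∷ adjacent-sym y₁ ∷ y₂ ∷ adjacent-sym z₂ ∷ z₃ ∷ k₃₄ ∷ k₄₅ ∷ [-]) refl

    -- The path is w, c₄, c₅, c₁, x, c₂, y, c₃, z.
    path-via-c₄ : ∀ {w x y z} → Triple x → Triple y → Triple z → r w c₄ ≡ true → HasPath (w ∷ x ∷ y ∷ z ∷ C)
    path-via-c₄ {w} {x} {y} {z} (x₁ , x₂ , _) (_ , y₂ , y₃) (_ , _ , z₃) h = go K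
      where
      go : Clique C → HasPath (w ∷ x ∷ y ∷ z ∷ C)
      go ((_ ∷ _ ∷ _ ∷ k₁₅ ∷ _) ∷ _ ∷ _ ∷ (k₄₅ ∷ _) ∷ _) =
        spanning (reindex w (x ∷ y ∷ z ∷ C) (0 ∷ 7 ∷ 8 ∷ 4 ∷ 1 ∷ 5 ∷ 2 ∷ 6 ∷ 3 ∷ []) refl)
          (h ∷ k₄₅ ∷ adjacent-sym k₁₅ ∷ adjacent-sym x₁ ∷ x₂ ∷ adjacent-sym y₂ ∷ y₃ ∷ adjacent-sym z₃ ∷ [-]) refl

    path-via-c₅ : ∀ {w x y z} → Triple x → Triple y → Triple z → r w c₅ ≡ true → HasPath (w ∷ x ∷ y ∷ z ∷ C)
    path-via-c₅ {w} {x} {y} {z} (x₁ , x₂ , _) (_ , y₂ , y₃) (_ , _ , z₃) h = go K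
      where
      go : Clique C → HasPath (w ∷ x ∷ y ∷ z ∷ C)
      go ((_ ∷ _ ∷ k₁₄ ∷ _ ∷ _) ∷ _ ∷ _ ∷ (k₄₅ ∷ _) ∷ _) =
        spanning (reindex w (x ∷ y ∷ z ∷ C) (0 ∷ 8 ∷ 7 ∷ 4 ∷ 1 ∷ 5 ∷ 2 ∷ 6 ∷ 3 ∷ []) refl)
          (h ∷ adjacent-sym k₄₅ ∷ adjacent-sym k₁₄ ∷ adjacent-sym x₁ ∷ x₂ ∷ adjacent-sym y₂ ∷ y₃ ∷ adjacent-sym z₃ ∷ [-]) refl

    -- A neighbour of y in `zs`, or c₄ or c₅, completes one of the three explicit paths; otherwise
    -- only c₁, c₂ and c₃ are left for its three neighbours.
    next-triple : ∀ {y zs} → 3 ≤ length zs → All Triple zs → 3 ≤ deg y (zs ++ C) →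
      HasPath (y ∷ zs ++ C) ⊎ Triple y
    next-triple {y} {zs} ≥3 ts d with search (r y) zs
    ... | inj₁ (z , zs′ , σ , e) = inj₁ (go zs′ σ (↭.All-resp-↭ σ ts) (subst (3 ≤_) (↭-length σ) ≥3))
      where
      go : ∀ zs′ → zs ↭ z ∷ zs′ → All Triple (z ∷ zs′) → 3 ≤ length (z ∷ zs′) → HasPath (y ∷ zs ++ C)
      go []      _ _ (s≤s ())
      go (_ ∷ []) _ _ (s≤s (s≤s ()))
      go (z′ ∷ z″ ∷ zs″) σ (t ∷ t′ ∷ t″ ∷ _) _ =
        hasPath-⊆ {ys = zs″} (prep y (trans (++⁺ʳ C σ) (prep z (prep z′ (prep z″ (++-comm zs″ C))))))
          (path-via-triple t t′ t″ e)
    ... | inj₂ none = outside zs ≥3 ts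
      where
      outside : ∀ zs′ → 3 ≤ length zs′ → All Triple zs′ → HasPath (y ∷ zs′ ++ C) ⊎ Triple y
      outside (_ ∷ [])     (s≤s ())
      outside (_ ∷ _ ∷ []) (s≤s (s≤s ()))
      outside (z ∷ z′ ∷ z″ ∷ zs″) _ (t ∷ t′ ∷ t″ ∷ _) = decide (r y c₄) (r y c₅) refl refl
        where
        larger : HasPath (y ∷ z ∷ z′ ∷ z″ ∷ C) → HasPath (y ∷ (z ∷ z′ ∷ z″ ∷ zs″) ++ C)
        larger = hasPath-⊆ {ys = zs″} (prep y (prep z (prep z′ (prep z″ (++-comm zs″ C)))))
        decide : ∀ b b′ → r y c₄ ≡ b → r y c₅ ≡ b′ → HasPath (y ∷ (z ∷ z′ ∷ z″ ∷ zs″) ++ C) ⊎ Triple y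
        decide true  _     h _  = inj₁ (larger (path-via-c₄ t t′ t″ h))
        decide false true  _ h  = inj₁ (larger (path-via-c₅ t t′ t″ h))
        decide false false h h′ = inj₂ (all-three (count-full {r y} (c₁ ∷ c₂ ∷ c₃ ∷ []) three))
          where
          all-three : All (λ c → r y c ≡ true) (c₁ ∷ c₂ ∷ c₃ ∷ []) → Triple y
          all-three (a ∷ b ∷ c ∷ []) = a , b , c
          three : 3 ≤ deg y (c₁ ∷ c₂ ∷ c₃ ∷ [])
          three = subst (3 ≤_) (≡.trans (count-++ (r y) zs C) (≡.trans (cong (_+ deg y C) (count-none none))
            (≡.trans (count-++ (r y) (c₁ ∷ c₂ ∷ c₃ ∷ []) (c₄ ∷ c₅ ∷ []))
              (≡.trans (cong (deg y (c₁ ∷ c₂ ∷ c₃ ∷ []) +_) (count-none {P = r y} (h ∷ h′ ∷ []))) (+-identityʳ _))))) d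

    all-triples : ∀ ys {zs} → 3 ≤ length zs → Thick C (ys ++ zs) → All Triple zs →
      HasPath ((ys ++ zs) ++ C) ⊎ All Triple (ys ++ zs)
    all-triples []       ≥3 t       ts = inj₂ ts
    all-triples (y ∷ ys) {zs} ≥3 (d ∷ t) ts with all-triples ys ≥3 t ts
    ... | inj₁ path = inj₁ (hasPath-⊆ {ys = y ∷ []} (++-comm (y ∷ []) ((ys ++ zs) ++ C)) path)
    ... | inj₂ ts′  = Sum.map₂ (_∷ ts′) (next-triple
            (≤-trans ≥3 (≤-trans (m≤n+m _ (length ys)) (≤-reflexive (sym (length-++ ys))))) ts′ d)

    edges-isolated : ∀ xs {ys} → All (λ x → deg x (xs ++ ys) ≡ 0) xs → edges (xs ++ ys) ≡ edges ys
    edges-isolated []       []       = refl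
    edges-isolated (x ∷ xs) (d ∷ ds) = cong₂ _+_ (m+n≡0⇒n≡0 (bit (r x x)) d)
      (edges-isolated xs (All.map (λ {y} → m+n≡0⇒n≡0 (bit (r y x))) ds))

    -- An edge from an added vertex to another one or to c₄ extends to a P₉ through further added
    -- vertices, which is why four of them are required.
    independent : ∀ xs → 4 ≤ length xs → All Triple xs → HasPath (xs ++ C) ⊎ edges (xs ++ c₄ ∷ []) ≡ 0
    independent xs ≥4 ts = Sum.map₂ (edges-isolated xs) (each xs λ {z} {zs} σ →
      isolated zs σ (↭.All-resp-↭ σ ts) (subst (4 ≤_) (↭-length σ) ≥4) (search (r z) zs))
      where
      larger : ∀ {w x y z zs} → xs ↭ w ∷ x ∷ y ∷ z ∷ zs → HasPath (w ∷ x ∷ y ∷ z ∷ C) → HasPath (xs ++ C)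
      larger {w} {x} {y} {z} {zs} σ = hasPath-⊆ {ys = zs}
        (trans (++⁺ʳ C σ) (prep w (prep x (prep y (prep z (++-comm zs C))))))
      isolated : ∀ {z} zs → xs ↭ z ∷ zs → All Triple (z ∷ zs) → 4 ≤ length (z ∷ zs) →
        (∃₂ λ z′ zs′ → zs ↭ z′ ∷ zs′ × r z z′ ≡ true) ⊎ All (λ z′ → r z z′ ≡ false) zs →
        HasPath (xs ++ C) ⊎ deg z (xs ++ c₄ ∷ []) ≡ 0
      isolated {z} zs σ (t ∷ ts) ≥4 (inj₁ (z′ , zs′ , τ , e)) =
        inj₁ (go zs′ τ (↭.All-resp-↭ τ ts) (subst (3 ≤_) (↭-length τ) (≤-pred ≥4)))
        where
        go : ∀ zs′ → zs ↭ z′ ∷ zs′ → All Triple (z′ ∷ zs′) → 3 ≤ length (z′ ∷ zs′) → HasPath (xs ++ C)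
        go []       _ _ (s≤s ())
        go (_ ∷ []) _ _ (s≤s (s≤s ()))
        go (y ∷ y′ ∷ _) τ (t₁ ∷ t₂ ∷ t₃ ∷ _) _ = larger (trans σ (prep z τ)) (path-via-triple t₁ t₂ t₃ e)
      isolated zs σ ts ≥4 (inj₂ none) = go zs σ ts ≥4 none
        where
        go : ∀ {z} zs → xs ↭ z ∷ zs → All Triple (z ∷ zs) → 4 ≤ length (z ∷ zs) →
          All (λ z′ → r z z′ ≡ false) zs → HasPath (xs ++ C) ⊎ deg z (xs ++ c₄ ∷ []) ≡ 0
        go []           _ _ (s≤s ())
        go (_ ∷ [])     _ _ (s≤s (s≤s ()))
        go (_ ∷ _ ∷ []) _ _ (s≤s (s≤s (s≤s ())))
        go {z} zs@(_ ∷ _ ∷ _ ∷ _) σ (_ ∷ t₁ ∷ t₂ ∷ t₃ ∷ _) _ none = bool-cases (r z c₄)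
          (λ h → inj₁ (larger σ (path-via-c₄ t₁ t₂ t₃ h)))
          (λ h → inj₂ (≡.trans (count-↭ (r z) (++⁺ʳ (c₄ ∷ []) σ)) (≡.trans (deg-self z (zs ++ c₄ ∷ []))
            (≡.trans (noEdges-deg zs (h ∷ [])) (count-none none)))))

  Independent : List A → Set
  Independent L = ∃₂ λ I q → L ↭ I ++ q × length I ≡ 13 × edges I ≡ 0

  -- 46 = 3 · 12 + 10 leaves no slack: the core is K₅, and each of the twelve stripped vertices has
  -- exactly three neighbours at its removal. The neighbours of the vertex stripped last are c₁, c₂,
  -- c₃, and they turn out to serve all twelve.
  five-case : ∀ {L xs p} → L ↭ xs ++ p → Stripped p xs → length p ≡ 5 → length xs ≡ 12 → 46 ≤ edges L →
    HasPath L ⊎ Independent L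
  five-case {L} {xs} {p} σ s h h′ 46≤
    with thick {k = 10} s (≤-trans (edges≤tri p) (≤-reflexive (cong tri h)))
           (subst (λ n → 3 * n + 10 ≤ edges (xs ++ p)) (sym h′) (≤-trans 46≤ (≤-reflexive (edges-↭ σ))))
  ... | t , 10≤ with split-end 4 xs (≤-trans (m≤m+n 4 8) (≤-reflexive (sym h′)))
  ...   | ys , x₄ ∷ x₃ ∷ x₂ ∷ x₁ ∷ [] , refl , refl with thick-suffix ys t
  ...     | _ ∷ _ ∷ _ ∷ d₁ ∷ [] with pick p d₁
  ...       | c₁ , p₁ , τ₁ , e₁ , k₁ with pick p₁ k₁
  ...         | c₂ , p₂ , τ₂ , e₂ , k₂ with pick p₂ k₂
  ...           | c₃ , p₃ , τ₃ , e₃ , _ =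
    go p₃ (trans τ₁ (prep c₁ (trans τ₂ (prep c₂ τ₃))))
      (≡.trans (sym (↭-length (trans τ₁ (prep c₁ (trans τ₂ (prep c₂ τ₃)))))) h)
    where
    go : ∀ p₃ → p ↭ c₁ ∷ c₂ ∷ c₃ ∷ p₃ → 3 + length p₃ ≡ 5 → HasPath L ⊎ Independent L
    go (c₄ ∷ c₅ ∷ []) π _ = triples (second-triple (e₁ , e₂ , e₃) d₂ d₃ d₄)
      where
      open FiveClique (full-clique (c₁ ∷ c₂ ∷ c₃ ∷ c₄ ∷ c₅ ∷ []) (≤-trans 10≤ (≤-reflexive (edges-↭ π))))
      zs : List A
      zs = x₄ ∷ x₃ ∷ x₂ ∷ x₁ ∷ []
      t′ : Thick C (ys ++ zs)
      t′ = thick-↭ π t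
      d₂ : 3 ≤ deg x₂ (x₁ ∷ C)
      d₂ = case thick-suffix ys t′ of λ { (_ ∷ _ ∷ d ∷ _) → d }
      d₃ : 3 ≤ deg x₃ (x₂ ∷ x₁ ∷ C)
      d₃ = case thick-suffix ys t′ of λ { (_ ∷ d ∷ _) → d }
      d₄ : 3 ≤ deg x₄ (x₃ ∷ x₂ ∷ x₁ ∷ C)
      d₄ = case thick-suffix ys t′ of λ { (d ∷ _) → d }
      τ : L ↭ (ys ++ zs) ++ C
      τ = trans σ (++⁺ˡ (ys ++ zs) π)
      last-nine : HasPath (x₄ ∷ x₃ ∷ x₂ ∷ x₁ ∷ C) → HasPath L
      last-nine = hasPath-⊆ {ys = ys} (trans τ (trans (++-assoc ys zs C) (++-comm ys (zs ++ C))))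
      C↭ : (ys ++ zs) ++ C ↭ ((ys ++ zs) ++ c₄ ∷ []) ++ (c₁ ∷ c₂ ∷ c₃ ∷ c₅ ∷ [])
      C↭ = trans (++⁺ˡ (ys ++ zs) (shift c₄ (c₁ ∷ c₂ ∷ c₃ ∷ []) (c₅ ∷ [])))
        (↭-sym (++-assoc (ys ++ zs) (c₄ ∷ []) (c₁ ∷ c₂ ∷ c₃ ∷ c₅ ∷ [])))
      spread : HasPath ((ys ++ zs) ++ C) ⊎ All Triple (ys ++ zs) → HasPath L ⊎ Independent L
      spread (inj₁ path) = inj₁ (hasPath-↭ (↭-sym τ) path)
      spread (inj₂ ts) = Sum.map (hasPath-↭ (↭-sym τ))
        -- Besides the twelve added vertices, one of the two adjacent vertices c₄, c₅ can join the
        -- independent set, which gives thirteen.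
        (λ e → (ys ++ zs) ++ c₄ ∷ [] , c₁ ∷ c₂ ∷ c₃ ∷ c₅ ∷ [] , trans τ C↭ ,
          ≡.trans (length-++ (ys ++ zs)) (cong (_+ 1) h′) , e)
        (independent (ys ++ zs) (≤-trans (m≤m+n 4 8) (≤-reflexive (sym h′))) ts)
      triples₃ : Triple x₂ → HasPath (x₄ ∷ x₃ ∷ x₂ ∷ x₁ ∷ C) ⊎ Triple x₃ → HasPath L ⊎ Independent L
      triples₃ t₂ (inj₁ path) = inj₁ (last-nine path)
      -- Three vertices with the common triple are now available, so explicit paths replace the
      -- search.
      triples₃ t₂ (inj₂ t₃) with next-triple {x₄} {x₃ ∷ x₂ ∷ x₁ ∷ []} ≤-refl (t₃ ∷ t₂ ∷ (e₁ , e₂ , e₃) ∷ []) d₄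
      ... | inj₁ path = inj₁ (last-nine path)
      ... | inj₂ t₄   = spread (all-triples ys (m≤m+n 3 1) t′ (t₄ ∷ t₃ ∷ t₂ ∷ (e₁ , e₂ , e₃) ∷ []))
      triples : HasPath (x₄ ∷ x₃ ∷ x₂ ∷ x₁ ∷ C) ⊎ Triple x₂ → HasPath L ⊎ Independent L
      triples (inj₁ path) = inj₁ (last-nine path)
      triples (inj₂ t₂)   = triples₃ t₂ (third-triple (e₁ , e₂ , e₃) t₂ d₃ d₄)

  -- Large vertex sets without edges between them

  Gap : ℕ → ℕ → List A → Set
  Gap a b L = ∃₂ λ X Y → ∃ λ M → L ↭ (X ++ Y) ++ M × NoEdges X Y × length X ≡ a × length Y ≡ b

  noEdges-sym : ∀ xs {ys} → NoEdges xs ys → NoEdges ys xs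
  noEdges-sym xs {[]}     h = []
  noEdges-sym xs {y ∷ ys} h =
    All.map (λ {x} h′ → ≡.trans (r-sym y x) (All.head h′)) h ∷ noEdges-sym xs (All.map All.tail h)

  gap : ∀ a b {L} p q → L ↭ p ++ q → NoEdges p q → a ≤ length p → b ≤ length q → Gap a b L
  gap a b p q σ ne a≤ b≤ with split-end a p a≤ | split-end b q b≤
  ... | p′ , X , refl , lx | q′ , Y , refl , ly =
    X , Y , p′ ++ q′ , trans σ (trans (++-assoc p′ X (q′ ++ Y)) (trans (++⁺ˡ p′ (shifts X q′)) (trans (↭-sym (++-assoc p′ q′ (X ++ Y))) (++-comm (p′ ++ q′) (X ++ Y))))) ,
    All.map (λ {x} → ++⁻ʳ q′) (++⁻ʳ p′ ne) , lx , ly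

  module _ (T b c : ℕ) where

    Bounded : ℕ → Set
    Bounded y = b ≤ (T ∸ y) + (21 + tri y) → T ∸ y ≤ c

    bounded? : ∀ y → Dec (Bounded y)
    bounded? y = (b ≤? (T ∸ y) + (21 + tri y)) →-dec (T ∸ y ≤? c)

    -- With k + y fixed, many pendant vertices leave few others, so the edge bound drops below `b`;
    -- the finitely many values of y are checked by evaluation.
    few-pendants : True (Fin.all? {suc T} (bounded? ∘ toℕ)) → ∀ k y → k + y ≡ T →
      k ≤ c ⊎ b ≤ k + (21 + tri y) → k ≤ c
    few-pendants h k y e (inj₁ k≤c) = k≤c
    few-pendants h k y refl (inj₂ b≤) = subst (_≤ c) (m+n∸n≡m k y)
      (subst Bounded (Fin.toℕ-fromℕ< (s≤s (m≤n+m y k))) (toWitness h (fromℕ< (s≤s (m≤n+m y k))))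
        (subst (λ j → b ≤ j + (21 + tri y)) (sym (m+n∸n≡m k y)) b≤))

  dense-17 : ∀ L → length L ≡ 17 → 46 ≤ edges L → HasPath L ⊎ Gap 7 9 L ⊎ Independent L
  dense-17 L h 46≤ with some-core L (≤-trans (m≤m+n 3 14) (≤-reflexive (sym h)))
                          (≤-trans (≤-reflexive (cong (3 *_) h)) (+-monoˡ-≤ 5 46≤))
  ... | inj₁ (inj₁ path) = inj₁ path
  ... | inj₁ (inj₂ big) with cut big
  ...   | inj₁ path = inj₁ path
  ...   | inj₂ (k , p , q , σ , ne , lp , bound) = inj₂ (inj₁ (wide k lp lengths
            -- Already k = 3 would allow only 3 + 21 + 21 = 45 edges.
            (few-pendants 10 46 2 tt k (length q) lengths
              (Sum.map (λ k≤ → ≤-trans k≤ (m≤m+n 1 1)) (≤-trans 46≤) bound))))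
    where
    lengths : k + length q ≡ 10
    lengths = +-cancelˡ-≡ 7 _ _ (≡.trans (cong (_+ length q) (sym lp)) (≡.trans (sym (length-↭-++ p σ)) h))
    wide : ∀ k → length p ≡ 7 + k → k + length q ≡ 10 → k ≤ 2 → Gap 7 9 L
    wide 0 lp lq _ = gap 7 9 p q σ ne (≤-reflexive (sym lp)) (≤-trans (m≤m+n 9 1) (≤-reflexive (sym lq)))
    wide 1 lp lq _ = gap 7 9 p q σ ne (≤-trans (m≤m+n 7 1) (≤-reflexive (sym lp))) (≤-reflexive (sym (cong pred lq)))
    -- Here the core side has nine vertices and the other side eight, so the two exchange roles.
    wide 2 lp lq _ = gap 7 9 q p (trans σ (++-comm p q)) (noEdges-sym p ne)
      (≤-trans (m≤m+n 7 1) (≤-reflexive (sym (cong (λ n → n ∸ 2) lq)))) (≤-reflexive (sym lp))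
    wide (suc (suc (suc k))) _ _ (s≤s (s≤s ()))
  dense-17 L h 46≤ | inj₂ (xs , p , σ , s , c , p≤6) with m≤n⇒m<n∨m≡n p≤6
  ... | inj₂ ≡6 = inj₁ (six-case σ s c ≡6
    (+-cancelʳ-≡ 6 _ _ (≡.trans (cong (length xs +_) (sym ≡6)) (≡.trans (sym (length-↭-++ xs σ)) h))) 46≤)
  ... | inj₁ <6 = Sum.map₂ inj₂ (five-case σ s ≡5
    (+-cancelʳ-≡ 5 _ _ (≡.trans (cong (length xs +_) (sym ≡5)) (≡.trans (sym (length-↭-++ xs σ)) h))) 46≤)
    where
    ≡5 : length p ≡ 5
    ≡5 = ≤-antisym (≤-pred <6) (Core.atLeast c)

  -- The sizes 5 and 4 are what an alternating P₉ takes once all edges across the gap have the one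
  -- remaining colour.
  dense-13 : ∀ L → length L ≡ 13 → 39 ≤ edges L → HasPath L ⊎ Gap 5 4 L
  dense-13 L h 39≤ with big-core _ L ≤-refl (≤-trans (m≤m+n 1 12) (≤-reflexive (sym h)))
                          (≤-trans (≤-reflexive (cong (3 *_) h)) (≤-trans 39≤ (m≤m+n _ 2)))
  ... | inj₁ path = inj₁ path
  ... | inj₂ big with cut big
  ...   | inj₁ path = inj₁ path
  ...   | inj₂ (k , p , q , σ , ne , lp , bound) = inj₂ (gap 5 4 p q σ ne
            (≤-trans (m≤m+n 5 (2 + k)) (≤-reflexive (sym lp)))
            -- The edge bound of `Cut` is at most 21 + 15 = 36 here, short of 39, so k ≤ 1.
            (≤-trans (n≤1+n 4) (wide k (few-pendants 6 39 1 tt k (length q) lengths (Sum.map₂ (≤-trans 39≤) bound)) lengths)))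
    where
    lengths : k + length q ≡ 6
    lengths = +-cancelˡ-≡ 7 _ _ (≡.trans (cong (_+ length q) (sym lp)) (≡.trans (sym (length-↭-++ p σ)) h))
    wide : ∀ k → k ≤ 1 → k + length q ≡ 6 → 5 ≤ length q
    wide 0 _ e = ≤-trans (n≤1+n 5) (≤-reflexive (sym e))
    wide 1 _ e = ≤-reflexive (sym (cong pred e))
    wide (suc (suc k)) (s≤s ()) _

  -- Four vertices with five neighbours each among nine

  disjoint : ∀ {x y} R → All (λ b → r x b ∧ r y b ≡ false) R → deg x R + deg y R ≤ length R
  disjoint []      []       = z≤n
  disjoint {x} {y} (b ∷ R) (h ∷ hs) = ≤-trans (≤-reflexive (arith (bit (r x b)) (deg x R) (bit (r y b)) (deg y R)))
    (+-mono-≤ (exclusive (r x b) (r y b) h) (disjoint R hs))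
    where
    arith : ∀ a b c d → a + b + (c + d) ≡ a + c + (b + d)
    arith = solve-∀
    exclusive : ∀ u v → u ∧ v ≡ false → bit u + bit v ≤ 1
    exclusive true  false _ = ≤-refl
    exclusive false v     _ = bit≤1 v

  CommonNeighbour : A → A → List A → Set
  CommonNeighbour x y R = ∃₂ λ b R′ → R ↭ b ∷ R′ × r x b ≡ true × r y b ≡ true

  common? : ∀ x y R → CommonNeighbour x y R ⊎ All (λ b → r x b ∧ r y b ≡ false) R
  common? x y R with search (λ b → r x b ∧ r y b) R
  ... | inj₁ (b , R′ , σ , h) = inj₁ (b , R′ , σ , ∧-true h)
  ... | inj₂ none = inj₂ none

  common : ∀ {x y R} → length R < deg x R + deg y R → CommonNeighbour x y R
  common {x} {y} {R} h with common? x y R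
  ... | inj₁ c    = c
  ... | inj₂ none = ⊥-elim (<⇒≱ h (disjoint R none))

  -- Pairwise disjoint neighbourhoods in `R` would have total size at most that of `R`.
  common-of-three : ∀ {x y z R} → length R < deg x R + deg y R + deg z R →
    CommonNeighbour x y R ⊎ CommonNeighbour x z R ⊎ CommonNeighbour y z R
  common-of-three {x} {y} {z} {R} h with common? x y R | common? x z R | common? y z R
  ... | inj₁ c  | _       | _       = inj₁ c
  ... | inj₂ _  | inj₁ c  | _       = inj₂ (inj₁ c)
  ... | inj₂ _  | inj₂ _  | inj₁ c  = inj₂ (inj₂ c)
  ... | inj₂ xy | inj₂ xz | inj₂ yz = ⊥-elim (<⇒≱ h (go R xy xz yz))
    where
    arith : ∀ a b c d e f → a + b + (c + d) + (e + f) ≡ a + c + e + (b + d + f)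
    arith = solve-∀
    exclusive : ∀ u v w → u ∧ v ≡ false → u ∧ w ≡ false → v ∧ w ≡ false → bit u + bit v + bit w ≤ 1
    exclusive true  false false _ _ _ = ≤-refl
    exclusive false true  false _ _ _ = ≤-refl
    exclusive false false w     _ _ _ = bit≤1 w
    go : ∀ R → All (λ b → r x b ∧ r y b ≡ false) R → All (λ b → r x b ∧ r z b ≡ false) R →
      All (λ b → r y b ∧ r z b ≡ false) R → deg x R + deg y R + deg z R ≤ length R
    go []      []       []       []       = z≤n
    go (b ∷ R) (p ∷ ps) (q ∷ qs) (s ∷ ss) =
      ≤-trans (≤-reflexive (arith (bit (r x b)) (deg x R) (bit (r y b)) (deg y R) (bit (r z b)) (deg z R)))
        (+-mono-≤ (exclusive (r x b) (r y b) (r z b) p q s) (go R ps qs ss))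

  deg-rest : ∀ {d x B R} bs → B ↭ bs ++ R → length bs + d ≤ deg x B → d ≤ deg x R
  deg-rest {d} {x} {B} {R} bs σ h = +-cancelˡ-≤ (length bs) _ _ (begin
    length bs + d        ≤⟨ h ⟩
    deg x B              ≡⟨ count-↭ (r x) σ ⟩
    deg x (bs ++ R)      ≡⟨ count-++ (r x) bs R ⟩
    deg x bs + deg x R   ≤⟨ +-monoˡ-≤ (deg x R) (count≤length (r x) bs) ⟩
    length bs + deg x R  ∎)

  module FourStars {B : List A} (nine : length B ≡ 9) where

    Rich : A → Set
    Rich a = 5 ≤ deg a B

    length-rest : ∀ {xs R} → B ↭ xs ++ R → length xs + length R ≡ 9
    length-rest {xs} σ = ≡.trans (sym (length-↭-++ xs σ)) nine

    -- The path is e, p, b₁, q, b₂, s, b₃, t, f. Besides b₁, b₂, b₃ both p and t have at least two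
    -- neighbours, so e and f can be chosen distinct.
    open-ends : ∀ {p q s t b₁ b₂ b₃ R} → B ↭ b₁ ∷ b₂ ∷ b₃ ∷ R → Rich p → Rich t →
      r p b₁ ≡ true → r q b₁ ≡ true → r q b₂ ≡ true → r s b₂ ≡ true → r s b₃ ≡ true → r t b₃ ≡ true →
      HasPath (p ∷ q ∷ s ∷ t ∷ B)
    open-ends {p} {q} {s} {t} {b₁} {b₂} {b₃} {R} σ rp rt h₁ h₂ h₃ h₄ h₅ h₆
      with pick R (deg-rest (b₁ ∷ b₂ ∷ b₃ ∷ []) σ rp)
    ... | e , R′ , τ , pe , _ with pick R′ (deg-rest (b₁ ∷ b₂ ∷ b₃ ∷ e ∷ []) (trans σ (prep b₁ (prep b₂ (prep b₃ τ)))) rt)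
    ...   | f , R″ , τ′ , tf , _ = hasPath-⊆ {ys = R″}
      (prep p (prep q (prep s (prep t (trans σ (prep b₁ (prep b₂ (prep b₃ (trans τ (prep e τ′))))))))))
      (spanning (reindex p (q ∷ s ∷ t ∷ b₁ ∷ b₂ ∷ b₃ ∷ e ∷ f ∷ []) (7 ∷ 0 ∷ 4 ∷ 1 ∷ 5 ∷ 2 ∷ 6 ∷ 3 ∷ 8 ∷ []) refl)
        (adjacent-sym pe ∷ h₁ ∷ adjacent-sym h₂ ∷ h₃ ∷ adjacent-sym h₄ ∷ h₅ ∷ adjacent-sym h₆ ∷ tf ∷ [-]) refl)

    -- Among the seven vertices other than b and b′, each of x, z, w has at least three neighbours,
    -- so two of them share one. If w is one of the two, it prolongs the chain x, y, z. Otherwise x,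
    -- b, y, b′, z lie on a 6-cycle; w enters it at b or b′, or has five neighbours among the seven
    -- and shares one with x, as 5 + 3 > 7.
    fourth : ∀ {x y z w b b′ R} → B ↭ b ∷ b′ ∷ R → Rich x → Rich y → Rich z → Rich w →
      r x b ≡ true → r y b ≡ true → r y b′ ≡ true → r z b′ ≡ true → HasPath (w ∷ x ∷ y ∷ z ∷ B)
    fourth {x} {y} {z} {w} {b} {b′} {R} σ rx ry rz rw xb yb yb′ zb′ =
      by-pair (common-of-three {x} {z} {w} (<-≤-trans (≤-reflexive (cong suc seven))
        (≤-trans (m≤n+m 8 1) (+-mono-≤ (+-mono-≤ (rest rx) (rest rz)) (rest rw)))))
      where
      seven : length R ≡ 7
      seven = +-cancelˡ-≡ 2 _ _ (length-rest {b ∷ b′ ∷ []} σ)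
      rest : ∀ {a} → Rich a → 3 ≤ deg a R
      rest ra = deg-rest (b ∷ b′ ∷ []) σ ra
      via-x : CommonNeighbour x w R → HasPath (w ∷ x ∷ y ∷ z ∷ B)
      via-x (c , R′ , τ , xc , wc) =
        open-ends (trans σ (trans (prep b (prep b′ τ)) (shift c (b ∷ b′ ∷ []) R′))) rw rz wc xc xb yb yb′ zb′
      by-pair : CommonNeighbour x z R ⊎ CommonNeighbour x w R ⊎ CommonNeighbour z w R → HasPath (w ∷ x ∷ y ∷ z ∷ B)
      by-pair (inj₂ (inj₁ c)) = via-x c
      by-pair (inj₂ (inj₂ (c , R′ , τ , zc , wc))) =
        hasPath-↭ (trans (++-comm (x ∷ y ∷ z ∷ []) (w ∷ B)) (prep w (++-comm B (x ∷ y ∷ z ∷ []))))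
          (open-ends (trans σ (prep b (prep b′ τ))) rx rw xb yb yb′ zb′ zc wc)
      by-pair (inj₁ (c , R′ , τ , xc , zc)) = on-cycle (r w b) (r w b′) refl refl
        where
        on-cycle : ∀ u u′ → r w b ≡ u → r w b′ ≡ u′ → HasPath (w ∷ x ∷ y ∷ z ∷ B)
        on-cycle true _ wb _ = hasPath-↭ (prep w (prep x (swap z y refl)))
          (open-ends (trans σ (prep b (trans (prep b′ τ) (swap b′ c refl)))) rw ry wb xb xc zc zb′ yb′)
        on-cycle false true _ wb′ = hasPath-↭ (prep w (swap y x refl))
          (open-ends (trans σ (swap b b′ τ)) rw rz wb′ yb′ yb xb xc zc)
        on-cycle false false wb wb′ = via-x (common (<-≤-trans (≤-reflexive (cong suc seven))
          (+-mono-≤ (rest rx) (subst (5 ≤_) (≡.trans (count-↭ (r w) σ) (cong₂ (λ u u′ → bit u + (bit u′ + deg w R)) wb wb′)) rw))))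

    -- The same argument one step earlier: 4 + 4 + 4 > 8 links a₃ to the chain unless a₁ and a₂
    -- share a second neighbour. Then a₃ is adjacent to b, or shares a neighbour with a₁, as 4 + 5 >
    -- 8.
    third : ∀ {a₁ a₂ a₃ w b R} → B ↭ b ∷ R → Rich a₁ → Rich a₂ → Rich a₃ → Rich w →
      r a₁ b ≡ true → r a₂ b ≡ true → HasPath (w ∷ a₁ ∷ a₂ ∷ a₃ ∷ B)
    third {a₁} {a₂} {a₃} {w} {b} {R} σ r₁ r₂ r₃ rw b₁ b₂ =
      by-pair (common-of-three {a₁} {a₂} {a₃} (<-≤-trans (≤-reflexive (cong suc eight))
        (≤-trans (m≤n+m 9 3) (+-mono-≤ (+-mono-≤ (rest r₁) (rest r₂)) (rest r₃)))))
      where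
      eight : length R ≡ 8
      eight = +-cancelˡ-≡ 1 _ _ (length-rest {b ∷ []} σ)
      rest : ∀ {a} → Rich a → 4 ≤ deg a R
      rest ra = deg-rest (b ∷ []) σ ra
      via-a₁ : CommonNeighbour a₁ a₃ R → HasPath (w ∷ a₁ ∷ a₂ ∷ a₃ ∷ B)
      via-a₁ (c , R′ , τ , c₁ , c₃) = hasPath-↭ (prep w (trans (swap a₃ a₁ refl) (prep a₁ (swap a₃ a₂ refl))))
        (fourth (trans σ (trans (prep b τ) (swap b c refl))) r₃ r₁ r₂ rw c₃ c₁ b₁ b₂)
      by-pair : CommonNeighbour a₁ a₂ R ⊎ CommonNeighbour a₁ a₃ R ⊎ CommonNeighbour a₂ a₃ R →
        HasPath (w ∷ a₁ ∷ a₂ ∷ a₃ ∷ B)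
      by-pair (inj₂ (inj₁ c)) = via-a₁ c
      by-pair (inj₂ (inj₂ (c , R′ , τ , c₂ , c₃))) = fourth (trans σ (prep b τ)) r₁ r₂ r₃ rw b₁ b₂ c₂ c₃
      by-pair (inj₁ (c , R′ , τ , c₁ , c₂)) = bool-cases (r a₃ b)
        (λ b₃ → fourth (trans σ (trans (prep b τ) (swap b c refl))) r₁ r₂ r₃ rw c₁ c₂ b₂ b₃)
        (λ b₃ → via-a₁ (common (<-≤-trans (≤-reflexive (cong suc eight)) (+-mono-≤ (rest r₁)
          (subst (5 ≤_) (≡.trans (count-↭ (r a₃) σ) (cong (λ u → bit u + deg a₃ R) b₃)) r₃)))))

    four-stars : ∀ {a₁ a₂ a₃ a₄} → Rich a₁ → Rich a₂ → Rich a₃ → Rich a₄ → HasPath (a₁ ∷ a₂ ∷ a₃ ∷ a₄ ∷ B)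
    four-stars {a₁} {a₂} {a₃} {a₄} r₁ r₂ r₃ r₄ with common {a₂} {a₃} (<-≤-trans (≤-reflexive (cong suc nine)) (+-mono-≤ r₂ r₃))
    ... | b , R , σ , b₂ , b₃ = third σ r₂ r₃ r₄ r₁ b₂ b₃

  rich-side : ∀ {X B} → length B ≡ 9 → 4 ≤ length X → All (λ a → 5 ≤ deg a B) X → HasPath (X ++ B)
  rich-side {_ ∷ []}         _ (s≤s ())
  rich-side {_ ∷ _ ∷ []}     _ (s≤s (s≤s ()))
  rich-side {_ ∷ _ ∷ _ ∷ []} _ (s≤s (s≤s (s≤s ())))
  rich-side {a₁ ∷ a₂ ∷ a₃ ∷ a₄ ∷ X} {B} nine _ (r₁ ∷ r₂ ∷ r₃ ∷ r₄ ∷ _) =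
    hasPath-⊆ {ys = X} (prep a₁ (prep a₂ (prep a₃ (prep a₄ (++-comm X B))))) (FourStars.four-stars nine r₁ r₂ r₃ r₄)

  complete-bipartite : ∀ {X Y} → length X ≡ 5 → length Y ≡ 4 →
    All (λ x → All (λ y → r x y ≡ true) Y) X → HasPath (X ++ Y)
  complete-bipartite {x₁ ∷ x₂ ∷ x₃ ∷ x₄ ∷ x₅ ∷ []} {y₁ ∷ y₂ ∷ y₃ ∷ y₄ ∷ []} _ _
    ((h₁ ∷ _) ∷ (h₂ ∷ h₃ ∷ _) ∷ (_ ∷ h₄ ∷ h₅ ∷ _) ∷ (_ ∷ _ ∷ h₆ ∷ h₇ ∷ []) ∷ (_ ∷ _ ∷ _ ∷ h₈ ∷ []) ∷ []) =
    spanning (reindex x₁ (x₂ ∷ x₃ ∷ x₄ ∷ x₅ ∷ y₁ ∷ y₂ ∷ y₃ ∷ y₄ ∷ []) (0 ∷ 5 ∷ 1 ∷ 6 ∷ 2 ∷ 7 ∷ 3 ∷ 8 ∷ 4 ∷ []) refl)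
      (h₁ ∷ adjacent-sym h₂ ∷ h₃ ∷ adjacent-sym h₄ ∷ h₅ ∷ adjacent-sym h₆ ∷ h₇ ∷ adjacent-sym h₈ ∷ [-]) refl

-- Three colours

unique-↭ : ∀ {A : Set} {xs ys : List A} → xs ↭ ys → Unique xs → Unique ys
unique-↭ {A} σ = Unique-resp-↭ (↭⇒↭ₛ σ)
  where open import Data.List.Relation.Binary.Permutation.Setoid.Properties (≡.setoid A) using (Unique-resp-↭)

unique-prefix : ∀ {A : Set} {zs : List A} xs {ys} → zs ↭ xs ++ ys → Unique zs → Unique xs
unique-prefix xs {ys} σ u = go xs (unique-↭ σ u)
  where
  go : ∀ xs → Unique (xs ++ ys) → Unique xs
  go []       _       = []
  go (x ∷ xs) (d ∷ u) = ++⁻ˡ xs d ∷ go xs u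

unique-cross : ∀ {A : Set} xs {ys : List A} → Unique (xs ++ ys) → All (λ x → All (x ≢_) ys) xs
unique-cross []       _       = []
unique-cross (x ∷ xs) (d ∷ u) = ++⁻ʳ xs d ∷ unique-cross xs u

module Colours {A : Set} (r : Fin 3 → A → A → Bool)
  (r-sym : ∀ c x y → r c x y ≡ r c y x) (r-irrefl : ∀ c x → r c x x ≡ false) where

  module G (c : Fin 3) = SimpleGraph (r c) (r-sym c) (r-irrefl c)
  open ≤-Reasoning

  Monochromatic : List A → Set
  Monochromatic L = ∃ λ c → G.HasPath c L

  Partition : Fin 3 → Fin 3 → Fin 3 → Set
  Partition i j k = ∀ {x y} → x ≢ y → bit (r i x y) + (bit (r j x y) + bit (r k x y)) ≡ 1

  regroup : ∀ a b c d e f → a + b + (c + d + (e + f)) ≡ (a + (c + e)) + (b + (d + f))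
  regroup = solve-∀

  module _ {i j k : Fin 3} (partition : Partition i j k) where

    degrees-sum : ∀ {x L} → All (x ≢_) L → G.deg i x L + (G.deg j x L + G.deg k x L) ≡ length L
    degrees-sum []       = refl
    degrees-sum {x} {y ∷ L} (d ∷ ds) = ≡.trans
      (regroup (bit (r i x y)) (G.deg i x L) (bit (r j x y)) (G.deg j x L) (bit (r k x y)) (G.deg k x L))
      (cong₂ _+_ (partition d) (degrees-sum ds))

    edges-sum : ∀ {L} → Unique L → G.edges i L + (G.edges j L + G.edges k L) ≡ tri (length L)
    edges-sum []       = refl
    edges-sum {x ∷ L} (d ∷ u) = ≡.trans
      (regroup (G.deg i x L) (G.edges i L) (G.deg j x L) (G.edges j L) (G.deg k x L) (G.edges k L))
      (cong₂ _+_ (degrees-sum d) (edges-sum u))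

    two-degrees : ∀ {x L} → All (x ≢_) L → All (λ y → r i x y ≡ false) L → G.deg j x L + G.deg k x L ≡ length L
    two-degrees {x} {L} d h = ≡.trans (cong (_+ (G.deg j x L + G.deg k x L)) (sym (count-none h))) (degrees-sum d)

    -- Seven vertices send nine edges each, so four of them send five edges in the same colour.
    two-coloured-bipartite : ∀ {X Y} → Unique (X ++ Y) → G.NoEdges i X Y → length X ≡ 7 → length Y ≡ 9 →
      Monochromatic (X ++ Y)
    two-coloured-bipartite {X} {Y} u ne lx ly with separate (λ x → 4 <ᵇ G.deg j x Y) X
    ... | P , Q , σ , hP , hQ = choose (4 ≤? length P)
      where
      richP : All (λ x → 5 ≤ G.deg j x Y) P
      richP = All.map (λ {x} h → <ᵇ⇒< 4 _ (subst T (sym h) tt)) hP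
      poorQ : ∀ {x} → (4 <ᵇ G.deg j x Y) ≡ false → G.deg j x Y ≤ 4
      poorQ h = ≮⇒≥ (λ lt → subst T h (<⇒<ᵇ lt))
      rich : ∀ {x} → All (x ≢_) Y → All (λ y → r i x y ≡ false) Y → G.deg j x Y ≤ 4 → 5 ≤ G.deg k x Y
      rich {x} d h poor = +-cancelˡ-≤ 4 _ _ (begin
        9                            ≡⟨ ly ⟨
        length Y                     ≡⟨ two-degrees d h ⟨
        G.deg j x Y + G.deg k x Y    ≤⟨ +-monoˡ-≤ _ poor ⟩
        4 + G.deg k x Y              ∎)
      all-rich : ∀ {Q} → All (λ x → All (x ≢_) Y) Q → G.NoEdges i Q Y →
        All (λ x → (4 <ᵇ G.deg j x Y) ≡ false) Q → All (λ x → 5 ≤ G.deg k x Y) Q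
      all-rich []       []       []       = []
      all-rich (d ∷ ds) (n ∷ ns) (h ∷ hs) = rich d n (poorQ h) ∷ all-rich ds ns hs
      richQ : All (λ x → 5 ≤ G.deg k x Y) Q
      richQ = all-rich (++⁻ʳ P (↭.All-resp-↭ σ (unique-cross X u))) (++⁻ʳ P (↭.All-resp-↭ σ ne)) hQ
      choose : Dec (4 ≤ length P) → Monochromatic (X ++ Y)
      choose (yes ≥4) = j , G.hasPath-⊆ j {ys = Q}
        (trans (++⁺ʳ Y σ) (trans (++-assoc P Q Y) (trans (++⁺ˡ P (++-comm Q Y)) (↭-sym (++-assoc P Y Q)))))
        (G.rich-side j ly ≥4 richP)
      choose (no ≱4) = k , G.hasPath-⊆ k {ys = P}
        (trans (++⁺ʳ Y σ) (trans (++-assoc P Q Y) (++-comm P (Q ++ Y))))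
        (G.rich-side k ly (+-cancelˡ-≤ 3 _ _ (begin
          7                      ≡⟨ lx ⟨
          length X               ≡⟨ G.length-↭-++ i P σ ⟩
          length P + length Q    ≤⟨ +-monoˡ-≤ (length Q) (≤-pred (≰⇒> ≱4)) ⟩
          3 + length Q           ∎)) richQ)

    edgeless : ∀ xs {ys} → G.edges i (xs ++ ys) ≡ 0 → G.NoEdges i xs ys
    edgeless []       h = []
    edgeless (x ∷ xs) {ys} h =
      ++⁻ʳ xs (count-zero (xs ++ ys) (m+n≡0⇒m≡0 _ h)) ∷
      edgeless xs (m+n≡0⇒n≡0 (G.deg i x (xs ++ ys)) h)

    third-colour : ∀ {X Y} → All (λ x → All (x ≢_) Y) X → G.NoEdges i X Y → G.NoEdges j X Y →
      All (λ x → All (λ y → r k x y ≡ true) Y) X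
    third-colour []       []       []       = []
    third-colour (d ∷ ds) (n ∷ ns) (m ∷ ms) = row d n m ∷ third-colour ds ns ms
      where
      only : ∀ {a b c} → bit a + (bit b + bit c) ≡ 1 → a ≡ false → b ≡ false → c ≡ true
      only {c = true} _ refl refl = refl
      row : ∀ {x Y} → All (x ≢_) Y → All (λ y → r i x y ≡ false) Y → All (λ y → r j x y ≡ false) Y →
        All (λ y → r k x y ≡ true) Y
      row []       []       []       = []
      row (d ∷ ds) (n ∷ ns) (m ∷ ms) = only (partition d) n m ∷ row ds ns ms

    -- Colour `i` is absent from `I`, and colour `j` is absent across the gap, so the gap is a K₅,₄
    -- in colour `k`.
    dense-in-two : ∀ {I} → Unique I → length I ≡ 13 → G.edges i I ≡ 0 → 39 ≤ G.edges j I → Monochromatic I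
    dense-in-two {I} u l e 39≤ with G.dense-13 j I l 39≤
    ... | inj₁ path = j , path
    ... | inj₂ (X , Y , M , σ , ne , lx , ly) = k , G.hasPath-⊆ k σ (G.complete-bipartite k lx ly
            (third-colour (unique-cross X (unique-prefix (X ++ Y) σ u)) (edgeless X without) ne))
      where
      without : G.edges i (X ++ Y) ≡ 0
      without = n≤0⇒n≡0 (begin
        G.edges i (X ++ Y)          ≤⟨ prefix (X ++ Y) ⟩
        G.edges i ((X ++ Y) ++ _)   ≡⟨ G.edges-↭ i σ ⟨
        G.edges i I                 ≡⟨ e ⟩
        0                           ∎)
        where
        prefix : ∀ xs {ys} → G.edges i xs ≤ G.edges i (xs ++ ys)
        prefix []       = z≤n
        prefix (x ∷ xs) {ys} = +-mono-≤ (≤-trans (m≤m+n _ (G.deg i x ys)) (≤-reflexive (sym (count-++ (r i x) xs ys)))) (prefix xs)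

  swap-last : ∀ {i j k} → Partition i j k → Partition i k j
  swap-last {i} {j} {k} p {x} {y} d = ≡.trans (cong (bit (r i x y) +_) (+-comm (bit (r k x y)) (bit (r j x y)))) (p d)

  dense-colour : ∀ {i j k} → Partition i j k → ∀ {L} → Unique L → length L ≡ 17 → 46 ≤ G.edges i L → Monochromatic L
  dense-colour {i} {j} {k} p {L} u l 46≤ with G.dense-17 i L l 46≤
  ... | inj₁ path = i , path
  ... | inj₂ (inj₁ (X , Y , M , σ , ne , lx , ly)) =
    let c , path = two-coloured-bipartite p (unique-prefix (X ++ Y) σ u) ne lx ly in c , G.hasPath-⊆ c σ path
  ... | inj₂ (inj₂ (I , M , σ , lI , e)) = let c , path = on-independent in c , G.hasPath-⊆ c σ path
    where
    uI : Unique I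
    uI = unique-prefix I σ u
    on-independent : Monochromatic I
    -- Thirteen vertices span 78 edges, all in two colours, and one of these has at least half of
    -- them.
    on-independent with 39 ≤? G.edges j I
    ... | yes ≥ = dense-in-two p uI lI e ≥
    ... | no ≱  = dense-in-two (swap-last {i} {j} {k} p) uI lI e (+-cancelˡ-≤ 39 _ _ (begin
      78                                              ≡⟨ cong tri lI ⟨
      tri (length I)                                  ≡⟨ edges-sum p uI ⟨
      G.edges i I + (G.edges j I + G.edges k I)       ≡⟨ cong (_+ (G.edges j I + G.edges k I)) e ⟩
      G.edges j I + G.edges k I                       ≤⟨ +-monoˡ-≤ _ (<⇒≤ (≰⇒> ≱)) ⟩
      39 + G.edges k I                                ∎))

  monochromatic-path : Partition (# 0) (# 1) (# 2) → Partition (# 1) (# 0) (# 2) → Partition (# 2) (# 0) (# 1) →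
    ∀ {L} → Unique L → length L ≡ 17 → Monochromatic L
  monochromatic-path p₀ p₁ p₂ {L} u l with 46 ≤? G.edges (# 0) L | 46 ≤? G.edges (# 1) L | 46 ≤? G.edges (# 2) L
  ... | yes ≥ | _     | _     = dense-colour p₀ u l ≥
  ... | no _  | yes ≥ | _     = dense-colour p₁ u l ≥
  ... | no _  | no _  | yes ≥ = dense-colour p₂ u l ≥
  ... | no a  | no b  | no c  = ⊥-elim (<⇒≱ (m≤m+n 136 0) (begin
    136                                                              ≡⟨ cong tri l ⟨
    tri (length L)                                                   ≡⟨ edges-sum p₀ u ⟨
    G.edges (# 0) L + (G.edges (# 1) L + G.edges (# 2) L)            ≤⟨ +-mono-≤ (≤-pred (≰⇒> a)) (+-mono-≤ (≤-pred (≰⇒> b)) (≤-pred (≰⇒> c))) ⟩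
    135                                                              ∎))

-- From paths in lists to embeddings of P₉ in K₁₇

lookup-unique : ∀ {A : Set} {xs : List A} → Unique xs → Injective _≡_ _≡_ (lookup xs)
lookup-unique {xs = x ∷ xs} (d ∷ u) {Fin.zero}  {Fin.zero}  e = refl
lookup-unique {xs = x ∷ xs} (d ∷ u) {Fin.zero}  {Fin.suc j} e = ⊥-elim (All.lookup d (∈-lookup j) e)
lookup-unique {xs = x ∷ xs} (d ∷ u) {Fin.suc i} {Fin.zero}  e = ⊥-elim (All.lookup d (∈-lookup i) (sym e))
lookup-unique {xs = x ∷ xs} (d ∷ u) {Fin.suc i} {Fin.suc j} e = cong Fin.suc (lookup-unique u e)

lookup-linked : ∀ {A : Set} {R : A → A → Set} {xs} → Linked R xs → ∀ i j → toℕ j ≡ suc (toℕ i) →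
  R (lookup xs i) (lookup xs j)
lookup-linked (h ∷ l) Fin.zero    (Fin.suc Fin.zero) e = h
lookup-linked (h ∷ l) (Fin.suc i) (Fin.suc j)        e = lookup-linked l i j (suc-injective e)

arrows : Arrows 3 (path 9) 17
arrows c = embed (monochromatic-path (partition exactly₀) (partition exactly₁) (partition exactly₂)
    (allFin⁺ 17) refl)
  where
  r : Fin 3 → Fin 17 → Fin 17 → Bool
  -- The values of `colour` on the diagonal are arbitrary; excluding them makes `r` irreflexive.
  r i x y = not (does (x Fin.≟ y)) ∧ does (colour c x y Fin.≟ i)

  does-≟-sym : ∀ (x y : Fin 17) → does (x Fin.≟ y) ≡ does (y Fin.≟ x)
  does-≟-sym x y with x Fin.≟ y
  ... | yes refl = sym (dec-true (x Fin.≟ x) refl)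
  ... | no ne    = sym (dec-false (y Fin.≟ x) (ne ∘ sym))

  r-sym : ∀ i x y → r i x y ≡ r i y x
  r-sym i x y = cong₂ (λ b k → not b ∧ does (k Fin.≟ i)) (does-≟-sym x y) (colour-sym c x y)

  r-irrefl : ∀ i x → r i x x ≡ false
  r-irrefl i x = cong (λ b → not b ∧ does (colour c x x Fin.≟ i)) (dec-true (x Fin.≟ x) refl)

  open Colours r r-sym r-irrefl

  is : Fin 3 → Fin 3 → ℕ
  is i k = bit (does (k Fin.≟ i))

  exactly₀ : ∀ k → is (# 0) k + (is (# 1) k + is (# 2) k) ≡ 1
  exactly₀ Fin.zero                        = refl
  exactly₀ (Fin.suc Fin.zero)              = refl
  exactly₀ (Fin.suc (Fin.suc Fin.zero))    = refl

  exactly₁ : ∀ k → is (# 1) k + (is (# 0) k + is (# 2) k) ≡ 1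
  exactly₁ Fin.zero                        = refl
  exactly₁ (Fin.suc Fin.zero)              = refl
  exactly₁ (Fin.suc (Fin.suc Fin.zero))    = refl

  exactly₂ : ∀ k → is (# 2) k + (is (# 0) k + is (# 1) k) ≡ 1
  exactly₂ Fin.zero                        = refl
  exactly₂ (Fin.suc Fin.zero)              = refl
  exactly₂ (Fin.suc (Fin.suc Fin.zero))    = refl

  partition : ∀ {i j k} → (∀ l → is i l + (is j l + is k l) ≡ 1) → Partition i j k
  partition h {x} {y} ne rewrite dec-false (x Fin.≟ y) ne = h (colour c x y)

  adjacent : ∀ {i x y} → r i x y ≡ true → Adj (colourClass c i) x y
  adjacent {i} {x} {y} h with x Fin.≟ y | colour c x y Fin.≟ i
  ... | no ne | yes e = ne , e

  embed : Monochromatic (allFin 17) → ∃ λ i → path 9 ⊑ colourClass c i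
  embed (i , p , q , σ , l , h) =
    i , subst (λ n → path n ⊑ colourClass c i) h (lookup p , lookup-unique unique , preserves)
    where
    unique : Unique p
    unique = unique-prefix p (↭-sym σ) (allFin⁺ 17)
    preserves : ∀ {u v} → Adj (path (length p)) u v → Adj (colourClass c i) (lookup p u) (lookup p v)
    preserves {u} {v} (inj₁ e) = adjacent (lookup-linked l u v e)
    preserves {u} {v} (inj₂ e) = symm (colourClass c i) {lookup p v} {lookup p u} (adjacent (lookup-linked l v u e))

-- The lower bound

constant : ∀ {X : Set} {n} (g : Fin (suc n) → X) → (∀ i j → toℕ j ≡ suc (toℕ i) → g i ≡ g j) →
  ∀ i → g Fin.zero ≡ g i
constant g step Fin.zero = refl
constant {n = suc n} g step (Fin.suc i) = ≡.trans (step Fin.zero (Fin.suc Fin.zero) refl)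
  (constant (g ∘ Fin.suc) (λ j k e → step (Fin.suc j) (Fin.suc k) (cong suc e)) i)

-- K₁₆ is cut into four blocks of four vertices, and the edges between blocks
-- are coloured by the three perfect matchings of K₄: in colour i, the blocks
-- fall into two sides, each with eight vertices.
side within : Fin 3 → Fin 4 → Fin 2
side i a = Vec.lookup (Vec.lookup
  ((# 0 ∷ # 0 ∷ # 1 ∷ # 1 ∷ []) ∷ (# 0 ∷ # 1 ∷ # 0 ∷ # 1 ∷ []) ∷ (# 0 ∷ # 1 ∷ # 1 ∷ # 0 ∷ []) ∷ []) i) a
within i a = Vec.lookup (Vec.lookup
  ((# 0 ∷ # 1 ∷ # 0 ∷ # 1 ∷ []) ∷ (# 0 ∷ # 0 ∷ # 1 ∷ # 1 ∷ []) ∷ (# 0 ∷ # 0 ∷ # 1 ∷ # 1 ∷ []) ∷ []) i) a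

-- Edges inside a block could have any colour, since their ends lie on the same side in every
-- colour; the diagonal entries are set to 0.
blockColour : Fin 4 → Fin 4 → Fin 3
blockColour a b = Vec.lookup (Vec.lookup
  ((# 0 ∷ # 0 ∷ # 1 ∷ # 2 ∷ []) ∷ (# 0 ∷ # 0 ∷ # 2 ∷ # 1 ∷ []) ∷
   (# 1 ∷ # 2 ∷ # 0 ∷ # 0 ∷ []) ∷ (# 2 ∷ # 1 ∷ # 0 ∷ # 0 ∷ []) ∷ []) a) b

blockColour-sym : ∀ a b → blockColour a b ≡ blockColour b a
blockColour-sym = toWitness {a? = Fin.all? λ a → Fin.all? λ b → blockColour a b Fin.≟ blockColour b a} tt

blockColour-side : ∀ a b → side (blockColour a b) a ≡ side (blockColour a b) b
blockColour-side = toWitness {a? = Fin.all? λ a → Fin.all? λ b →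
  side (blockColour a b) a Fin.≟ side (blockColour a b) b} tt

block-determined : ∀ i a b → side i a ≡ side i b → within i a ≡ within i b → a ≡ b
block-determined = toWitness {a? = Fin.all? λ i → Fin.all? λ a → Fin.all? λ b →
  side i a Fin.≟ side i b →-dec (within i a Fin.≟ within i b →-dec a Fin.≟ b)} tt

-- The theorem asks for the Ramsey number itself, so minimality of 17 is needed. A path in colour
-- `i` stays on one side, where the block among the two (`within`) and the position in it take eight
-- values, too few for nine vertices. Embedding the vertices into 16 handles all smaller orders at
-- once.
no-arrows : ∀ {M} → M ≤ 16 → Arrows 3 (path 9) M → ⊥
no-arrows {M} M≤16 arrow = contradiction (arrow colouring)
  where
  block position : Fin M → Fin 4
  block v    = proj₁ (Fin.remQuot {4} 4 (Fin.inject≤ v M≤16))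
  position v = proj₂ (Fin.remQuot {4} 4 (Fin.inject≤ v M≤16))

  determined : ∀ u v → block u ≡ block v → position u ≡ position v → u ≡ v
  determined u v b p = Fin.inject≤-injective M≤16 M≤16 u v (≡.trans (sym (Fin.combine-remQuot {4} 4 _))
    (≡.trans (cong₂ Fin.combine b p) (Fin.combine-remQuot {4} 4 _)))

  colouring : EdgeColouring 3 (complete M)
  colouring = record
    { colour     = λ u v → blockColour (block u) (block v)
    ; colour-sym = λ u v → blockColour-sym (block u) (block v)
    }

  contradiction : (∃ λ i → path 9 ⊑ colourClass colouring i) → ⊥
  contradiction (i , f , injective , preserves) with Fin.pigeonhole (n<1+n 8) code
    where
    code : Fin 9 → Fin 8
    code u = Fin.combine (within i (block (f u))) (position (f u))
  ... | u , v , u<v , e = <-irrefl (cong toℕ (injective (determined (f u) (f v)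
          (block-determined i _ _ (≡.trans (sym (same-side u)) (same-side v)) (proj₁ codes)) (proj₂ codes)))) u<v
    where
    codes = Fin.combine-injective (within i (block (f u))) (position (f u)) (within i (block (f v))) (position (f v)) e
    same-side : ∀ u → side i (block (f Fin.zero)) ≡ side i (block (f u))
    same-side = constant (λ u → side i (block (f u))) λ u v e → step (preserves {u} {v} (inj₁ e))
      where
      step : ∀ {x y} → Adj (colourClass colouring i) x y → side i (block x) ≡ side i (block y)
      step {x} {y} (_ , refl) = blockColour-side (block x) (block y)

theorem8 : ∃[ N ] (IsRamseyNumber 3 (path 9) N × N ≤ 17)
theorem8 = 17 , (arrows , λ M arrow → ≮⇒≥ λ M<17 → no-arrows (≤-pred M<17) arrow) , ≤-refl
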